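{- Let $l,m,n\ge 0$ be integers and let $\Sigma=\big((+K_l)\vee_{ - }(+K_m)\big)\vee_{+}(+K_n)$. Then \[ \mathsf E(\Sigma,x)=H_3(l,m,n,x), \] \[ \mathsf O(\Sigma,x)=\mathsf E(\Sigma,x-1)+l\,H_3(l-1,m,n,x-1)+m\,H_3(l,m-1,n,x-1)+n\,H_3(l,m,n-1,x-1). \]
   Context: A signed graph $\Sigma=(\Gamma,\sigma)$ is a finite simple graph $\Gamma$ with a signature $\sigma:E(\Gamma)\to\{\pm1\}$. $+K_n$ is the complete graph on $n$ vertices with all edges positive ($+K_0$ is empty). For signed graphs $\Sigma_1,\Sigma_2$ on disjoint vertex sets, the all-positive join $\Sigma_1\vee_{+}\Sigma_2$ (resp. all-negative join $\Sigma_1\vee_{ - }\Sigma_2$) is obtained from their disjoint union by joining every vertex of $\Sigma_1$ to every vertex of $\Sigma_2$ by a positive (resp. negative) edge. For an integer $\lambda\ge 0$, let $C_\lambda$ be the set of nonzero integers in $[-\lambda/2,\lambda/2]$ if $\lambda$ is even, and the set of integers in $[-(\lambda-1)/2,(\lambda-1)/2]$ if $\lambda$ is odd. A proper $C_\lambda$-colouring of $\Sigma$ is a map $\kappa:V(\Gamma)\to C_\lambda$ with $\kappa(v)\ne\sigma(\{v,w\})\kappa(w)$ for every edge $\{v,w\}$; $f(\Sigma,\lambda)$ denotes their number. $\mathsf E(\Sigma,x),\mathsf O(\Sigma,x)\in\mathbb Z[x]$ are the unique polynomials with $f(\Sigma,\lambda)=\mathsf E(\Sigma,\lambda)$ for all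 even $\lambda\ge0$ and $f(\Sigma,\lambda)=\mathsf O(\Sigma,\lambda)$ for all odd $\lambda\ge0$. Notation: $(x)_n=\prod_{j=0}^{n-1}(x-j)$, ${}_2(x)_n=\prod_{j=0}^{n-1}(x-2j)$ (both $1$ for $n=0$). For integers $n\ge 2k\ge0$, $T(n,k)=\frac{(n)_{2k}}{2^k k!}$ is the number of $k$-edge matchings in $K_n$. For integers $l,m,n\ge0$, \[ H_3(l,m,n,x)=\sum_{i=0}^{\min(l,m)}\sum_{j=0}^{\lfloor (l-i)/2\rfloor}\sum_{k=0}^{\lfloor (m-i)/2\rfloor} i!\binom{l}{i}\binom{m}{i}T(l-i,j)\,T(m-i,k)\,{}_2(x)_{l+m-i-j-k}\,(x-l-m+i)_n, \] and $H_3(l,m,n,x)=0$ if any of $l,m,n$ is negative. -}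

module Defs where

open import Data.Nat as ℕ using (ℕ; zero; suc; _∸_; _/_; _%_; _!)
open import Data.Nat.Properties using (m*n≢0; m^n≢0; _!≢0)
open import Data.Nat.Combinatorics using (_C_)
open import Data.Integer as ℤ using (ℤ; +_; -_; _-_; 0ℤ; 1ℤ)
open import Data.Fin using (Fin; splitAt; _≟_)
open import Data.Sum using (inj₁; inj₂)
open import Data.Maybe using (Maybe; just; nothing)
open import Data.Bool using (Bool; true; false; if_then_else_; _∧_; not)
open import Data.List using (List; []; _∷_; _++_; map; upTo; length; filter; concatMap; allFin; foldr)
open import Data.Vec using (Vec; []; _∷_; lookup)
open import Relation.Nullary.Decidable using (⌊_⌋; T?)
open import Relation.Unary using (Decidable)

-- G i j = nothing : no edge between i and j
-- G i j = just s  : an edge {i,j} with sign s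
-- (all graphs built below are simple: symmetric and loopless by construction)

data Sign : Set where
  pos neg : Sign

sgn : Sign → ℤ
sgn pos = 1ℤ
sgn neg = - 1ℤ

SignedGraph : ℕ → Set
SignedGraph N = Fin N → Fin N → Maybe Sign

+K : (n : ℕ) → SignedGraph n
+K n i j = if ⌊ i ≟ j ⌋ then nothing else just pos

join : ∀ {a b} → Sign → SignedGraph a → SignedGraph b → SignedGraph (a ℕ.+ b)
join {a} s G₁ G₂ i j with splitAt a i | splitAt a j
... | inj₁ i′ | inj₁ j′ = G₁ i′ j′
... | inj₂ i′ | inj₂ j′ = G₂ i′ j′
... | inj₁ _  | inj₂ _  = just s
... | inj₂ _  | inj₁ _  = just s

_∨₊_ : ∀ {a b} → SignedGraph a → SignedGraph b → SignedGraph (a ℕ.+ b)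
_∨₊_ = join pos

_∨₋_ : ∀ {a b} → SignedGraph a → SignedGraph b → SignedGraph (a ℕ.+ b)
_∨₋_ = join neg

-- The colour set C_λ, listed without repetitions.
-- λ = 2k   : {-k,…,-1,1,…,k}
-- λ = 2k+1 : {-k,…,k}

colours : ℕ → List ℤ
colours c =
  map (λ i → - (+ suc i)) (upTo (c / 2))
  ++ (if ⌊ c % 2 ℕ.≟ 1 ⌋ then 0ℤ ∷ [] else [])
  ++ map (λ i → + suc i) (upTo (c / 2))

allVecs : ∀ {A : Set} → List A → (N : ℕ) → List (Vec A N)
allVecs Cs zero = [] ∷ []
allVecs Cs (suc N) = concatMap (λ x → map (x ∷_) (allVecs Cs N)) Cs

allᵇ : ∀ {A : Set} → (A → Bool) → List A → Bool
allᵇ p xs = foldr _∧_ true (map p xs)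

properᵇ : ∀ {N} → SignedGraph N → Vec ℤ N → Bool
properᵇ {N} G κ =
  allᵇ (λ i → allᵇ (λ j → ok (G i j) i j) (allFin N)) (allFin N)
  where
  ok : Maybe Sign → Fin N → Fin N → Bool
  ok nothing  _ _ = true
  ok (just s) i j = not ⌊ lookup κ i ℤ.≟ sgn s ℤ.* lookup κ j ⌋

f : ∀ {N} → SignedGraph N → ℕ → ℕ
f {N} G c = length (filter (λ κ → T? (properᵇ G κ)) (allVecs (colours c) N))


fall : ℤ → ℕ → ℤ
fall x zero = 1ℤ
fall x (suc n) = fall x n ℤ.* (x - + n)

fall₂ : ℤ → ℕ → ℤ
fall₂ x zero = 1ℤ
fall₂ x (suc n) = fall₂ x n ℤ.* (x - + (2 ℕ.* n))

fallℕ : ℕ → ℕ → ℕ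
fallℕ n zero = 1
fallℕ n (suc m) = fallℕ n m ℕ.* (n ∸ m)

T : ℕ → ℕ → ℕ
T n k = (fallℕ n (2 ℕ.* k) / (2 ℕ.^ k ℕ.* k !))
          {{m*n≢0 (2 ℕ.^ k) (k !) {{m^n≢0 2 k}} {{k !≢0}}}}

Σ[0≤_]_ : ℕ → (ℕ → ℤ) → ℤ
Σ[0≤ n ] g = foldr ℤ._+_ 0ℤ (map g (upTo (suc n)))

H₃ : ℕ → ℕ → ℕ → ℤ → ℤ
H₃ l m n x =
  Σ[0≤ ℕ._⊓_ l m ] λ i →
  Σ[0≤ (l ∸ i) / 2 ] λ j →
  Σ[0≤ (m ∸ i) / 2 ] λ k →
    + (i ! ℕ.* (l C i) ℕ.* (m C i) ℕ.* T (l ∸ i) j ℕ.* T (m ∸ i) k)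
    ℤ.* fall₂ x (l ℕ.+ m ∸ i ∸ j ∸ k)
    ℤ.* fall (x - + l - + m ℤ.+ + i) n

{-# OPTIONS --safe #-}
module Submission where

-- Colour the vertices one at a time: first the l vertices of +K_l, then the m of +K_m, then the n of +K_n.
-- Since the colour set C_λ is duplicate-free and closed under negation, the number of ways to finish a partial
-- colouring depends only on a few counts of colours (unused ones; for the first block also the used y with -y
-- unused, the pairs {y, -y} with both unused, and whether 0 is free), which turns f(Σ, λ) into an integer
-- recurrence.  For even λ = x there is no 0 and the recurrence has a closed form: the first block contributes
-- T(l, j) for the j pairs {y, -y} it uses completely, the second block chooses the i colours it shares with the
-- first, and T(l, j) (l - 2j)_i = i! C(l, i) T(l - i, j) rearranges the sum into H₃.  For odd λ the colour 0 is
-- used by at most one vertex; removing it leaves a colouring with λ - 1 colours of Σ with l, m or n lowered by one.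

open import Defs
open import Data.Nat using (ℕ; _∸_)
open import Data.Integer using (ℤ; +_; _+_; _*_; _-_; 1ℤ)
open import Data.Product using (_×_)
open import Relation.Binary.PropositionalEquality using (_≡_)

open import Data.Bool as Bool using (Bool; true; false; not; _∧_; _∨_; if_then_else_)
import Data.Bool.Properties as Bool
open import Data.Bool.ListAction using (all; and)
open import Data.Empty using (⊥-elim)
open import Data.Fin as Fin using (Fin; splitAt; _↑ˡ_; _↑ʳ_)
import Data.Fin.Properties as Fin
open import Data.Integer as ℤ using (-_; 0ℤ)
import Data.Integer.Properties as ℤ
open import Data.Integer.Tactic.RingSolver using (solve-∀)
open import Algebra.Properties.CommutativeSemigroup ℤ.+-commutativeSemigroup using () renaming (interchange to +-interchange)
open import Data.List using (List; []; _∷_; _++_; map; concatMap; filter; length; upTo; allFin; foldr; applyUpTo)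
import Data.List.Properties as List
open import Data.List.Membership.Propositional using (_∈_)
open import Data.List.Membership.Propositional.Properties using (∈-allFin; ∈-map⁺; ∈-map⁻; ∈-++⁻)
open import Data.List.Relation.Binary.Disjoint.Propositional using (Disjoint)
open import Data.List.Relation.Binary.Permutation.Propositional using (_↭_; ↭-reflexive; ↭-trans)
import Data.List.Relation.Binary.Permutation.Propositional.Properties as ↭
open import Data.List.Relation.Unary.All as All using (All)
open import Data.List.Relation.Unary.All.Properties using (all⁺; all⁻; tabulate⁺; ¬All⇒Any¬)
open import Data.List.Relation.Unary.AllPairs using ([]; _∷_)
open import Data.List.Relation.Unary.Any using (here; there; satisfied)
open import Data.List.Relation.Unary.Unique.Propositional using (Unique)
import Data.List.Relation.Unary.Unique.Propositional.Properties as Unique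
open import Data.Maybe using (Maybe; just; nothing)
open import Data.Nat as ℕ using (zero; suc; _!; _≤_; _<_; s≤s; _⊓_)
import Data.Nat.Properties as ℕ
import Data.Nat.DivMod as ℕ
open import Data.Nat.Combinatorics using (_C_; nCk+nC[k+1]≡[n+1]C[k+1]; k>n⇒nCk≡0)
open import Data.Nat.Tactic.RingSolver using () renaming (solve-∀ to solve-∀ℕ)
open import Data.Product using (_,_; ∃)
open import Data.Sum using (inj₁; inj₂)
open import Data.Vec as Vec using (Vec; []; _∷_; lookup; replicate)
import Data.Vec.Properties as Vec
open import Function using (_∘_; _∘′_)
open import Relation.Binary.PropositionalEquality
open import Relation.Nullary.Decidable using (Dec; yes; no; T?; ⌊_⌋; isYes≗does; dec-true; dec-false)
open import Relation.Nullary.Negation using (¬_)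

private variable
  A B : Set
  k : ℕ

cong₃ : ∀ {A B C D : Set} (f : A → B → C → D) {a a′ b b′ c c′} →
        a ≡ a′ → b ≡ b′ → c ≡ c′ → f a b c ≡ f a′ b′ c′
cong₃ f refl refl refl = refl

cong₄ : ∀ {A B C D E : Set} (f : A → B → C → D → E) {a a′ b b′ c c′ d d′} →
        a ≡ a′ → b ≡ b′ → c ≡ c′ → d ≡ d′ → f a b c d ≡ f a′ b′ c′ d′
cong₄ f refl refl refl refl = refl

⌊⌋-yes : ∀ {P : Set} (P? : Dec P) → P → ⌊ P? ⌋ ≡ true
⌊⌋-yes P? p = trans (isYes≗does P?) (dec-true P? p)

⌊⌋-no : ∀ {P : Set} (P? : Dec P) → ¬ P → ⌊ P? ⌋ ≡ false
⌊⌋-no P? ¬p = trans (isYes≗does P?) (dec-false P? ¬p)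

⌊⌋-⇔ : ∀ {P Q : Set} (P? : Dec P) (Q? : Dec Q) → (P → Q) → (Q → P) → ⌊ P? ⌋ ≡ ⌊ Q? ⌋
⌊⌋-⇔ P? Q? P→Q Q→P with P?
... | yes p = sym (⌊⌋-yes Q? (P→Q p))
... | no ¬p = sym (⌊⌋-no Q? (¬p ∘ Q→P))

𝟙 : Bool → ℤ
𝟙 true  = 1ℤ
𝟙 false = 0ℤ

count : (A → Bool) → List A → ℤ
count p []       = 0ℤ
count p (a ∷ xs) = 𝟙 (p a) + count p xs

sumOver : List A → (A → ℤ) → ℤ
sumOver []       h = 0ℤ
sumOver (a ∷ xs) h = h a + sumOver xs h

syntax sumOver xs (λ x → e) = ∑[ x ∈ xs ] e

length-filter-T? : (p : A → Bool) (xs : List A) → + length (filter (T? ∘ p) xs) ≡ count p xs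
length-filter-T? p []       = refl
length-filter-T? p (a ∷ xs) with p a
... | true  = cong (_+_ 1ℤ) (length-filter-T? p xs)
... | false = trans (length-filter-T? p xs) (sym (ℤ.+-identityˡ _))

count-cong-∈ : ∀ {p q : A → Bool} xs → (∀ {a} → a ∈ xs → p a ≡ q a) → count p xs ≡ count q xs
count-cong-∈ []       eq = refl
count-cong-∈ (a ∷ xs) eq = cong₂ (λ b c → 𝟙 b + c) (eq (here refl)) (count-cong-∈ xs (eq ∘ there))

count-cong : ∀ {p q : A → Bool} xs → (∀ a → p a ≡ q a) → count p xs ≡ count q xs
count-cong xs eq = count-cong-∈ xs (λ {a} _ → eq a)

count-++ : ∀ (p : A → Bool) xs ys → count p (xs ++ ys) ≡ count p xs + count p ys
count-++ p []       ys = sym (ℤ.+-identityˡ _)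
count-++ p (a ∷ xs) ys = trans (cong (_+_ (𝟙 (p a))) (count-++ p xs ys)) (sym (ℤ.+-assoc (𝟙 (p a)) (count p xs) (count p ys)))

count-map : ∀ (p : B → Bool) (g : A → B) xs → count p (map g xs) ≡ count (p ∘ g) xs
count-map p g []       = refl
count-map p g (a ∷ xs) = cong (_+_ (𝟙 (p (g a)))) (count-map p g xs)

count-concatMap : ∀ (p : B → Bool) (g : A → List B) xs →
                  count p (concatMap g xs) ≡ ∑[ a ∈ xs ] count p (g a)
count-concatMap p g []       = refl
count-concatMap p g (a ∷ xs) =
  trans (count-++ p (g a) (concatMap g xs)) (cong (_+_ (count p (g a))) (count-concatMap p g xs))

count-true : ∀ (xs : List A) → count (λ _ → true) xs ≡ + length xs
count-true []       = refl
count-true (a ∷ xs) = cong (_+_ 1ℤ) (count-true xs)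

count-false : ∀ (xs : List A) → count (λ _ → false) xs ≡ 0ℤ
count-false []       = refl
count-false (a ∷ xs) = trans (ℤ.+-identityˡ _) (count-false xs)

𝟙-split : ∀ b c → 𝟙 c ≡ 𝟙 (not b ∧ c) + 𝟙 (b ∧ c)
𝟙-split true  true  = refl
𝟙-split true  false = refl
𝟙-split false true  = refl
𝟙-split false false = refl

count-split : ∀ (q p : A → Bool) xs → count p xs ≡ count (λ a → not (q a) ∧ p a) xs + count (λ a → q a ∧ p a) xs
count-split q p []       = refl
count-split q p (a ∷ xs) =
  trans (cong₂ _+_ (𝟙-split (q a) (p a)) (count-split q p xs))
        (+-interchange (𝟙 (not (q a) ∧ p a)) (𝟙 (q a ∧ p a)) (count (λ a → not (q a) ∧ p a) xs) (count (λ a → q a ∧ p a) xs))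

count-∧ˡ : ∀ b (q : A → Bool) xs → count (λ a → b ∧ q a) xs ≡ 𝟙 b * count q xs
count-∧ˡ true  q xs = sym (ℤ.*-identityˡ _)
count-∧ˡ false q xs = count-false xs

count-↭ : ∀ (p : A → Bool) {xs ys} → xs ↭ ys → count p xs ≡ count p ys
count-↭ p {xs} {ys} xs↭ys = begin
  count p xs                           ≡⟨ length-filter-T? p xs ⟨
  + length (filter (T? ∘ p) xs)        ≡⟨ cong +_ (↭.↭-length (↭.filter-↭ (T? ∘ p) xs↭ys)) ⟩
  + length (filter (T? ∘ p) ys)        ≡⟨ length-filter-T? p ys ⟩
  count p ys                           ∎
  where open ≡-Reasoning

count-update : ∀ {p p′ : A → Bool} {x xs} → Unique xs → x ∈ xs →
               (∀ y → y ≢ x → p′ y ≡ p y) →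
               count p′ xs ≡ count p xs - 𝟙 (p x) + 𝟙 (p′ x)
count-update {p = p} {p′} {x} {_ ∷ xs} (x∉xs ∷ _) (here refl) agree =
  trans (cong (_+_ (𝟙 (p′ x))) (count-cong-∈ xs λ y∈xs → agree _ (λ { refl → All.lookup x∉xs y∈xs refl })))
        (swap (𝟙 (p′ x)) (𝟙 (p x)) (count p xs))
  where
  swap : ∀ a b c → a + c ≡ b + c - b + a
  swap = solve-∀
count-update {p = p} {p′} {x} {a ∷ xs} (a∉xs ∷ unique) (there x∈xs) agree =
  trans (cong₂ _+_ (cong 𝟙 (agree a λ { refl → All.lookup a∉xs x∈xs refl })) (count-update unique x∈xs agree))
        (assoc (𝟙 (p a)) (count p xs) (𝟙 (p x)) (𝟙 (p′ x)))
  where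
  assoc : ∀ a c d e → a + (c - d + e) ≡ a + c - d + e
  assoc = solve-∀

∑-cong-∈ : ∀ {h g : A → ℤ} xs → (∀ {a} → a ∈ xs → h a ≡ g a) → ∑[ a ∈ xs ] h a ≡ ∑[ a ∈ xs ] g a
∑-cong-∈ []       eq = refl
∑-cong-∈ (a ∷ xs) eq = cong₂ _+_ (eq (here refl)) (∑-cong-∈ xs (eq ∘ there))

∑-+ : ∀ (h g : A → ℤ) xs → ∑[ a ∈ xs ] (h a + g a) ≡ ∑[ a ∈ xs ] h a + ∑[ a ∈ xs ] g a
∑-+ h g []       = refl
∑-+ h g (a ∷ xs) = trans (cong (_+_ (h a + g a)) (∑-+ h g xs)) (+-interchange (h a) (g a) _ _)

∑-𝟙 : ∀ (c : A → Bool) v xs → ∑[ a ∈ xs ] (𝟙 (c a) * v) ≡ count c xs * v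
∑-𝟙 c v []       = sym (ℤ.*-zeroˡ v)
∑-𝟙 c v (a ∷ xs) = trans (cong (_+_ (𝟙 (c a) * v)) (∑-𝟙 c v xs)) (sym (ℤ.*-distribʳ-+ v (𝟙 (c a)) _))

negatives positives : ℕ → List ℤ
negatives h = map (λ i → - (+ suc i)) (upTo h)
positives h = map (λ i → + suc i) (upTo h)

zeroIf : Bool → List ℤ
zeroIf b = if b then 0ℤ ∷ [] else []

palette : ℕ → Bool → List ℤ
palette h b = negatives h ++ zeroIf b ++ positives h

palette-unique : ∀ h b → Unique (palette h b)
palette-unique h b =
  Unique.++⁺ (Unique.map⁺ ℤ.-[1+-injective (Unique.upTo⁺ h))
             (Unique.++⁺ (zeroIf-unique b) (Unique.map⁺ (ℕ.suc-injective ∘′ ℤ.+-injective) (Unique.upTo⁺ h))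
                         (zero-disjoint b))
             (negative-disjoint b)
  where
  zeroIf-unique : ∀ b → Unique (zeroIf b)
  zeroIf-unique true  = All.[] ∷ []
  zeroIf-unique false = []
  zero-disjoint : ∀ b → Disjoint (zeroIf b) (positives h)
  zero-disjoint true (here refl , v∈P) with ∈-map⁻ _ v∈P
  ... | _ , _ , ()
  negative-disjoint : ∀ b → Disjoint (negatives h) (zeroIf b ++ positives h)
  negative-disjoint b (v∈N , v∈ZP) with ∈-map⁻ _ v∈N | ∈-++⁻ (zeroIf b) v∈ZP
  ... | _ , _ , refl | inj₂ v∈P with ∈-map⁻ _ v∈P
  ...   | _ , _ , ()
  negative-disjoint true (v∈N , v∈ZP) | _ , _ , refl | inj₁ (here ())

palette-symmetric : ∀ h b → map -_ (palette h b) ↭ palette h b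
palette-symmetric h b = ↭-trans (↭-reflexive negated) (↭-trans (↭.++-comm (positives h) _)
                          (↭-trans (↭-reflexive (List.++-assoc (zeroIf b) _ _)) (↭.shifts (zeroIf b) (negatives h))))
  where
  negate-zeroIf : ∀ b → map -_ (zeroIf b) ≡ zeroIf b
  negate-zeroIf true  = refl
  negate-zeroIf false = refl
  negated : map -_ (palette h b) ≡ positives h ++ zeroIf b ++ negatives h
  negated = begin
    map -_ (palette h b)
      ≡⟨ List.map-++ -_ (negatives h) _ ⟩
    map -_ (negatives h) ++ map -_ (zeroIf b ++ positives h)
      ≡⟨ cong₂ _++_ (sym (List.map-∘ (upTo h))) (List.map-++ -_ (zeroIf b) _) ⟩
    positives h ++ map -_ (zeroIf b) ++ map -_ (positives h)
      ≡⟨ cong₂ (λ z n → positives h ++ z ++ n) (negate-zeroIf b) (sym (List.map-∘ (upTo h))) ⟩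
    positives h ++ zeroIf b ++ negatives h ∎
    where open ≡-Reasoning

count-palette : ∀ (p : ℤ → Bool) h b →
  count p (palette h b) ≡ count (λ i → p (- (+ suc i))) (upTo h) + count p (zeroIf b) + count (λ i → p (+ suc i)) (upTo h)
count-palette p h b = begin
  count p (palette h b)
    ≡⟨ count-++ p (negatives h) _ ⟩
  count p (negatives h) + count p (zeroIf b ++ positives h)
    ≡⟨ cong₂ _+_ (count-map p _ (upTo h)) (count-++ p (zeroIf b) _) ⟩
  ν + (ζ + count p (positives h))
    ≡⟨ ℤ.+-assoc ν ζ _ ⟨
  ν + ζ + count p (positives h)
    ≡⟨ cong (_+_ (ν + ζ)) (count-map p _ (upTo h)) ⟩
  ν + ζ + count (λ i → p (+ suc i)) (upTo h) ∎
  where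
  open ≡-Reasoning
  ν = count (λ i → p (- (+ suc i))) (upTo h)
  ζ = count p (zeroIf b)

-- Σ as a graph labelled by the three blocks

data Part : Set where
  L M N : Part

sign : Part → Part → Sign
sign L M = neg
sign M L = neg
sign _ _ = pos

sign-sym : ∀ t t′ → sign t t′ ≡ sign t′ t
sign-sym L L = refl
sign-sym L M = refl
sign-sym L N = refl
sign-sym M L = refl
sign-sym M M = refl
sign-sym M N = refl
sign-sym N L = refl
sign-sym N M = refl
sign-sym N N = refl

labelled : ∀ {k} → Vec Part k → SignedGraph k
labelled ps i j = if ⌊ i Fin.≟ j ⌋ then nothing else just (sign (lookup ps i) (lookup ps j))

infix 4 _≗ᴳ_

_≗ᴳ_ : ∀ {k} → SignedGraph k → SignedGraph k → Set
G ≗ᴳ H = ∀ i j → G i j ≡ H i j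

parts : ∀ l m n → Vec Part ((l ℕ.+ m) ℕ.+ n)
parts l m n = (replicate l L Vec.++ replicate m M) Vec.++ replicate n N

≟-injective : ∀ {a c} (f : Fin a → Fin c) → (∀ {x y} → f x ≡ f y → x ≡ y) →
              ∀ x y → ⌊ f x Fin.≟ f y ⌋ ≡ ⌊ x Fin.≟ y ⌋
≟-injective f f-inj x y = ⌊⌋-⇔ (f x Fin.≟ f y) (x Fin.≟ y) f-inj (cong f)

↑ˡ≢↑ʳ : ∀ {a b} (i : Fin a) (j : Fin b) → i ↑ˡ b ≢ a ↑ʳ j
↑ˡ≢↑ʳ {a} {b} i j eq with () ← trans (sym (Fin.splitAt-↑ˡ a i b)) (trans (cong (splitAt a) eq) (Fin.splitAt-↑ʳ a b j))

module _ {a b} (ps : Vec Part a) (qs : Vec Part b) where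

  labelled-↑ˡ↑ˡ : ∀ i j → labelled (ps Vec.++ qs) (i ↑ˡ b) (j ↑ˡ b) ≡ labelled ps i j
  labelled-↑ˡ↑ˡ i j = cong₂ (λ d s → if d then nothing else just s)
    (≟-injective (_↑ˡ b) (Fin.↑ˡ-injective b _ _) i j)
    (cong₂ sign (Vec.lookup-++ˡ ps qs i) (Vec.lookup-++ˡ ps qs j))

  labelled-↑ʳ↑ʳ : ∀ i j → labelled (ps Vec.++ qs) (a ↑ʳ i) (a ↑ʳ j) ≡ labelled qs i j
  labelled-↑ʳ↑ʳ i j = cong₂ (λ d s → if d then nothing else just s)
    (≟-injective (a ↑ʳ_) (Fin.↑ʳ-injective a _ _) i j)
    (cong₂ sign (Vec.lookup-++ʳ ps qs i) (Vec.lookup-++ʳ ps qs j))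

  labelled-↑ˡ↑ʳ : ∀ i j → labelled (ps Vec.++ qs) (i ↑ˡ b) (a ↑ʳ j) ≡ just (sign (lookup ps i) (lookup qs j))
  labelled-↑ˡ↑ʳ i j = cong₂ (λ d s → if d then nothing else just s)
    (⌊⌋-no (i ↑ˡ b Fin.≟ a ↑ʳ j) (↑ˡ≢↑ʳ i j))
    (cong₂ sign (Vec.lookup-++ˡ ps qs i) (Vec.lookup-++ʳ ps qs j))

  labelled-↑ʳ↑ˡ : ∀ i j → labelled (ps Vec.++ qs) (a ↑ʳ j) (i ↑ˡ b) ≡ just (sign (lookup qs j) (lookup ps i))
  labelled-↑ʳ↑ˡ i j = cong₂ (λ d s → if d then nothing else just s)
    (⌊⌋-no (a ↑ʳ j Fin.≟ i ↑ˡ b) (↑ˡ≢↑ʳ i j ∘ sym))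
    (cong₂ sign (Vec.lookup-++ʳ ps qs j) (Vec.lookup-++ˡ ps qs i))

  join-labelled : ∀ s {G H} → G ≗ᴳ labelled ps → H ≗ᴳ labelled qs →
                  (∀ i j → sign (lookup ps i) (lookup qs j) ≡ s) →
                  join s G H ≗ᴳ labelled (ps Vec.++ qs)
  join-labelled s {G} {H} G≗ H≗ cross i j with splitAt a i in ei | splitAt a j in ej
  ... | inj₁ i′ | inj₁ j′ = begin
    G i′ j′                                    ≡⟨ G≗ i′ j′ ⟩
    labelled ps i′ j′                          ≡⟨ labelled-↑ˡ↑ˡ i′ j′ ⟨
    labelled (ps Vec.++ qs) (i′ ↑ˡ b) (j′ ↑ˡ b)    ≡⟨ cong₂ (labelled (ps Vec.++ qs)) (Fin.splitAt⁻¹-↑ˡ ei) (Fin.splitAt⁻¹-↑ˡ ej) ⟩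
    labelled (ps Vec.++ qs) i j                    ∎
    where open ≡-Reasoning
  ... | inj₂ i′ | inj₂ j′ = begin
    H i′ j′                                    ≡⟨ H≗ i′ j′ ⟩
    labelled qs i′ j′                          ≡⟨ labelled-↑ʳ↑ʳ i′ j′ ⟨
    labelled (ps Vec.++ qs) (a ↑ʳ i′) (a ↑ʳ j′)    ≡⟨ cong₂ (labelled (ps Vec.++ qs)) (Fin.splitAt⁻¹-↑ʳ ei) (Fin.splitAt⁻¹-↑ʳ ej) ⟩
    labelled (ps Vec.++ qs) i j                    ∎
    where open ≡-Reasoning
  ... | inj₁ i′ | inj₂ j′ = begin
    just s                                     ≡⟨ cong just (cross i′ j′) ⟨
    just (sign (lookup ps i′) (lookup qs j′))  ≡⟨ labelled-↑ˡ↑ʳ i′ j′ ⟨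
    labelled (ps Vec.++ qs) (i′ ↑ˡ b) (a ↑ʳ j′)    ≡⟨ cong₂ (labelled (ps Vec.++ qs)) (Fin.splitAt⁻¹-↑ˡ ei) (Fin.splitAt⁻¹-↑ʳ ej) ⟩
    labelled (ps Vec.++ qs) i j                    ∎
    where open ≡-Reasoning
  ... | inj₂ i′ | inj₁ j′ = begin
    just s                                     ≡⟨ cong just (trans (sign-sym _ _) (cross j′ i′)) ⟨
    just (sign (lookup qs i′) (lookup ps j′))  ≡⟨ labelled-↑ʳ↑ˡ j′ i′ ⟨
    labelled (ps Vec.++ qs) (a ↑ʳ i′) (j′ ↑ˡ b)    ≡⟨ cong₂ (labelled (ps Vec.++ qs)) (Fin.splitAt⁻¹-↑ʳ ei) (Fin.splitAt⁻¹-↑ˡ ej) ⟩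
    labelled (ps Vec.++ qs) i j                    ∎
    where open ≡-Reasoning

+K-labelled : ∀ n t → sign t t ≡ pos → +K n ≗ᴳ labelled (replicate n t)
+K-labelled n t tt≡pos i j rewrite Vec.lookup-replicate i t | Vec.lookup-replicate j t | tt≡pos = refl

Σ : ∀ l m n → SignedGraph ((l ℕ.+ m) ℕ.+ n)
Σ l m n = ((+K l) ∨₋ (+K m)) ∨₊ (+K n)

Σ-labelled : ∀ l m n → Σ l m n ≗ᴳ labelled (parts l m n)
Σ-labelled l m n =
  join-labelled (replicate l L Vec.++ replicate m M) (replicate n N) pos
    (join-labelled (replicate l L) (replicate m M) neg (+K-labelled l L refl) (+K-labelled m M refl)
       (λ i j → cong₂ sign (Vec.lookup-replicate i L) (Vec.lookup-replicate j M)))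
    (+K-labelled n N refl)
    (λ i j → trans (cong (sign _) (Vec.lookup-replicate j N)) (into-N _))
  where
  into-N : ∀ t → sign t N ≡ pos
  into-N L = refl
  into-N M = refl
  into-N N = refl

-- Properness as a greedy left-to-right check

T-injective : ∀ {a b} → (Bool.T a → Bool.T b) → (Bool.T b → Bool.T a) → a ≡ b
T-injective {true}  {true}  _ _ = refl
T-injective {false} {false} _ _ = refl
T-injective {true}  {false} f _ = ⊥-elim (f _)
T-injective {false} {true}  _ g = ⊥-elim (g _)

all-cong : ∀ {A : Set} {p q : A → Bool} xs → (∀ a → p a ≡ q a) → all p xs ≡ all q xs
all-cong xs p≗q = cong and (List.map-cong p≗q xs)

signed : Sign → ℤ → ℤ
signed pos y = y
signed neg y = - y

sgn-* : ∀ s y → sgn s * y ≡ signed s y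
sgn-* pos y = ℤ.*-identityˡ y
sgn-* neg y = ℤ.-1*i≡-i y

edgeOk : Maybe Sign → ℤ → ℤ → Bool
edgeOk nothing  x y = true
edgeOk (just s) x y = not ⌊ x ℤ.≟ signed s y ⌋

proper : SignedGraph k → Vec ℤ k → Bool
proper {k} G κ = all (λ i → all (λ j → edgeOk (G i j) (lookup κ i) (lookup κ j)) (allFin k)) (allFin k)

proper-cong : ∀ {G H : SignedGraph k} κ → G ≗ᴳ H → proper G κ ≡ proper H κ
proper-cong {k} κ G≗H = all-cong (allFin k) λ i → all-cong (allFin k) λ j →
  cong (λ e → edgeOk e (lookup κ i) (lookup κ j)) (G≗H i j)

properᵇ⇒proper : ∀ (G : SignedGraph k) κ → Bool.T (properᵇ G κ) → Bool.T (proper G κ)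
properᵇ⇒proper G κ ok = all⁻ _ (tabulate⁺ λ i → all⁻ _ (tabulate⁺ λ j → edge i j))
  where
  edge : ∀ i j → Bool.T (edgeOk (G i j) (lookup κ i) (lookup κ j))
  edge i j with G i j | All.lookup (all⁺ _ _ (All.lookup (all⁺ _ _ ok) (∈-allFin i))) (∈-allFin j)
  ... | nothing | _  = _
  ... | just s  | ok = subst (λ z → Bool.T (not ⌊ lookup κ i ℤ.≟ z ⌋)) (sgn-* s (lookup κ j)) ok

all-false : ∀ {A : Set} (p : A → Bool) xs → all p xs ≡ false → ∃ λ a → p a ≡ false
all-false p xs notAll with satisfied (¬All⇒Any¬ (T? ∘ p) xs λ allOk → subst Bool.T notAll (all⁻ p allOk))
... | a , ¬pa = a , Bool.¬-not λ pa≡true → ¬pa (subst Bool.T (sym pa≡true) _)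

proper⇒properᵇ : ∀ (G : SignedGraph k) κ → Bool.T (proper G κ) → Bool.T (properᵇ G κ)
proper⇒properᵇ {k} G κ ok with properᵇ G κ in notOk
... | true = _
... | false with all-false _ (allFin k) notOk
... | i , badRow with all-false _ (allFin k) badRow
... | j , bad with G i j | bad | All.lookup (all⁺ _ _ (All.lookup (all⁺ _ _ ok) (∈-allFin i))) (∈-allFin j)
... | nothing | () | _
... | just s  | bad′ | edge = subst Bool.T bad′ (subst (λ z → Bool.T (not ⌊ lookup κ i ℤ.≟ z ⌋)) (sym (sgn-* s (lookup κ j))) edge)

properᵇ≡proper : ∀ (G : SignedGraph k) κ → properᵇ G κ ≡ proper G κ
properᵇ≡proper G κ = T-injective (properᵇ⇒proper G κ) (proper⇒properᵇ G κ)

conflict : Part → ℤ → Part → ℤ → Bool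
conflict t x t′ y = ⌊ x ℤ.≟ signed (sign t t′) y ⌋

signed-flip : ∀ s x y → x ≡ signed s y → y ≡ signed s x
signed-flip pos x y eq = sym eq
signed-flip neg x y eq = trans (sym (ℤ.neg-involutive y)) (cong -_ (sym eq))

conflict-sym : ∀ t x t′ y → conflict t′ y t x ≡ conflict t x t′ y
conflict-sym t x t′ y rewrite sign-sym t′ t =
  ⌊⌋-⇔ (y ℤ.≟ _) (x ℤ.≟ _) (signed-flip (sign t t′) y x) (signed-flip (sign t t′) x y)

compatibleWith : Part → ℤ → Vec Part k → Vec ℤ k → Bool
compatibleWith t x []        []      = true
compatibleWith t x (t′ ∷ ts) (y ∷ κ) = not (conflict t x t′ y) ∧ compatibleWith t x ts κ

pairwise : Vec Part k → Vec ℤ k → Bool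
pairwise []       []      = true
pairwise (t ∷ ts) (x ∷ κ) = compatibleWith t x ts κ ∧ pairwise ts κ

all-allFin-suc : ∀ {n} (p : Fin (ℕ.suc n) → Bool) → all p (allFin (ℕ.suc n)) ≡ p Fin.zero ∧ all (p ∘ Fin.suc) (allFin n)
all-allFin-suc {n} p = cong (λ bs → p Fin.zero ∧ and bs) (trans (List.map-tabulate Fin.suc p) (sym (List.map-tabulate (λ i → i) (p ∘ Fin.suc))))

all-∧ : ∀ {A : Set} (p q : A → Bool) xs → all (λ a → p a ∧ q a) xs ≡ all p xs ∧ all q xs
all-∧ p q []       = refl
all-∧ p q (a ∷ xs) = trans (cong ((p a ∧ q a) ∧_) (all-∧ p q xs)) (interchange (p a) (q a) _ _)
  where
  interchange : ∀ a b c d → (a ∧ b) ∧ (c ∧ d) ≡ (a ∧ c) ∧ (b ∧ d)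
  interchange true  true  c d = refl
  interchange true  false c d = sym (Bool.∧-zeroʳ c)
  interchange false b     c d = refl

compatibleWith-all : ∀ t x (ts : Vec Part k) κ →
  all (λ j → not (conflict t x (lookup ts j) (lookup κ j))) (allFin k) ≡ compatibleWith t x ts κ
compatibleWith-all t x []        []      = refl
compatibleWith-all t x (t′ ∷ ts) (y ∷ κ) =
  trans (all-allFin-suc (λ j → not (conflict t x (lookup (t′ ∷ ts) j) (lookup (y ∷ κ) j)))) (cong (not (conflict t x t′ y) ∧_) (compatibleWith-all t x ts κ))

proper-labelled-∷ : ∀ t x (ts : Vec Part k) κ →
  proper (labelled (t ∷ ts)) (x ∷ κ) ≡ compatibleWith t x ts κ ∧ proper (labelled ts) κ
proper-labelled-∷ {k} t x ts κ = begin
  proper (labelled (t ∷ ts)) (x ∷ κ)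
    ≡⟨ all-allFin-suc (λ i → all (e i) (allFin (ℕ.suc k))) ⟩
  all (e Fin.zero) (allFin (ℕ.suc k)) ∧ all (λ i → all (e (Fin.suc i)) (allFin (ℕ.suc k))) (allFin k)
    ≡⟨ cong₂ _∧_ (all-allFin-suc (e Fin.zero)) (all-cong (allFin k) λ i → all-allFin-suc (e (Fin.suc i))) ⟩
  all (λ j → e Fin.zero (Fin.suc j)) (allFin k) ∧ all (λ i → e (Fin.suc i) Fin.zero ∧ all (λ j → e (Fin.suc i) (Fin.suc j)) (allFin k)) (allFin k)
    ≡⟨ cong (compatibles ∧_) (all-cong (allFin k) λ i → cong₂ _∧_ (cong not (conflict-sym t x (lookup ts i) (lookup κ i)))
                                                       (all-cong (allFin k) λ j → inner i j)) ⟩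
  compatibles ∧ all (λ i → c i ∧ all (λ j → edgeOk (labelled ts i j) (lookup κ i) (lookup κ j)) (allFin k)) (allFin k)
    ≡⟨ cong (compatibles ∧_) (all-∧ c _ (allFin k)) ⟩
  compatibles ∧ (compatibles ∧ proper (labelled ts) κ)
    ≡⟨ Bool.∧-assoc compatibles compatibles _ ⟨
  (compatibles ∧ compatibles) ∧ proper (labelled ts) κ
    ≡⟨ cong₂ _∧_ (Bool.∧-idem compatibles) refl ⟩
  compatibles ∧ proper (labelled ts) κ
    ≡⟨ cong (_∧ proper (labelled ts) κ) (compatibleWith-all t x ts κ) ⟩
  compatibleWith t x ts κ ∧ proper (labelled ts) κ ∎
  where
  open ≡-Reasoning
  e : Fin (ℕ.suc k) → Fin (ℕ.suc k) → Bool
  e i j = edgeOk (labelled (t ∷ ts) i j) (lookup (x ∷ κ) i) (lookup (x ∷ κ) j)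
  c : Fin k → Bool
  c j = not (conflict t x (lookup ts j) (lookup κ j))
  compatibles : Bool
  compatibles = all c (allFin k)
  inner : ∀ i j → e (Fin.suc i) (Fin.suc j) ≡ edgeOk (labelled ts i j) (lookup κ i) (lookup κ j)
  inner i j = cong (λ d → edgeOk (if d then nothing else just (sign (lookup ts i) (lookup ts j))) (lookup κ i) (lookup κ j))
                   (≟-injective Fin.suc Fin.suc-injective i j)

proper-labelled : ∀ (ts : Vec Part k) κ → proper (labelled ts) κ ≡ pairwise ts κ
proper-labelled []       []      = refl
proper-labelled (t ∷ ts) (x ∷ κ) = trans (proper-labelled-∷ t x ts κ) (cong (compatibleWith t x ts κ ∧_) (proper-labelled ts κ))

-- Seen t y: some already coloured vertex of part t has colour y.
Seen : Set
Seen = Part → ℤ → Bool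

none : Seen
none _ _ = false

samePart : Part → Part → Bool
samePart L L = true
samePart M M = true
samePart N N = true
samePart _ _ = false

insert : ℤ → (ℤ → Bool) → ℤ → Bool
insert x A y = ⌊ y ℤ.≟ x ⌋ ∨ A y

use : Seen → Part → ℤ → Seen
use σ t x t′ = if samePart t′ t then insert x (σ t′) else σ t′

admissible : Seen → Part → ℤ → Bool
admissible σ t x = not (σ L (signed (sign t L) x) ∨ σ M (signed (sign t M) x) ∨ σ N (signed (sign t N) x))

greedy : Seen → Vec Part k → Vec ℤ k → Bool
greedy σ []       []      = true
greedy σ (t ∷ ts) (x ∷ κ) = admissible σ t x ∧ greedy (use σ t x) ts κ

admissibleAll : Seen → Vec Part k → Vec ℤ k → Bool
admissibleAll σ []       []      = true
admissibleAll σ (t ∷ ts) (x ∷ κ) = admissible σ t x ∧ admissibleAll σ ts κ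

blocks : ∀ t x t′ y → ⌊ signed (sign t′ t) y ℤ.≟ x ⌋ ≡ conflict t x t′ y
blocks t x t′ y rewrite sign-sym t′ t = ⌊⌋-⇔ (_ ℤ.≟ x) (x ℤ.≟ _) sym sym

admissible-use : ∀ σ t x t′ y → admissible (use σ t x) t′ y ≡ admissible σ t′ y ∧ not (conflict t x t′ y)
admissible-use σ L x t′ y rewrite sym (blocks L x t′ y) = first _ (σ L (signed (sign t′ L) y)) (σ M (signed (sign t′ M) y)) (σ N (signed (sign t′ N) y))
  where
  first : ∀ e a b c → not ((e ∨ a) ∨ b ∨ c) ≡ not (a ∨ b ∨ c) ∧ not e
  first true  a b c = sym (Bool.∧-zeroʳ _)
  first false a b c = sym (Bool.∧-identityʳ _)
admissible-use σ M x t′ y rewrite sym (blocks M x t′ y) = second _ (σ L (signed (sign t′ L) y)) (σ M (signed (sign t′ M) y)) (σ N (signed (sign t′ N) y))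
  where
  second : ∀ e a b c → not (a ∨ (e ∨ b) ∨ c) ≡ not (a ∨ b ∨ c) ∧ not e
  second true  true  b c = refl
  second true  false b c = sym (Bool.∧-zeroʳ _)
  second false a     b c = sym (Bool.∧-identityʳ _)
admissible-use σ N x t′ y rewrite sym (blocks N x t′ y) = third _ (σ L (signed (sign t′ L) y)) (σ M (signed (sign t′ M) y)) (σ N (signed (sign t′ N) y))
  where
  third : ∀ e a b c → not (a ∨ b ∨ (e ∨ c)) ≡ not (a ∨ b ∨ c) ∧ not e
  third true  true  b     c = refl
  third true  false true  c = refl
  third true  false false c = sym (Bool.∧-zeroʳ _)
  third false a     b     c = sym (Bool.∧-identityʳ _)

admissibleAll-use : ∀ σ t x (ts : Vec Part k) κ →
  admissibleAll (use σ t x) ts κ ≡ admissibleAll σ ts κ ∧ compatibleWith t x ts κ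
admissibleAll-use σ t x []        []      = refl
admissibleAll-use σ t x (t′ ∷ ts) (y ∷ κ)
  rewrite admissible-use σ t x t′ y | admissibleAll-use σ t x ts κ =
  interchange (admissible σ t′ y) (not (conflict t x t′ y)) _ _
  where
  interchange : ∀ a b c d → (a ∧ b) ∧ (c ∧ d) ≡ (a ∧ c) ∧ (b ∧ d)
  interchange true  true  c d = refl
  interchange true  false c d = sym (Bool.∧-zeroʳ c)
  interchange false b     c d = refl

greedy≡admissibleAll∧pairwise : ∀ σ (ts : Vec Part k) κ → greedy σ ts κ ≡ admissibleAll σ ts κ ∧ pairwise ts κ
greedy≡admissibleAll∧pairwise σ []       []      = refl
greedy≡admissibleAll∧pairwise σ (t ∷ ts) (x ∷ κ)
  rewrite greedy≡admissibleAll∧pairwise (use σ t x) ts κ | admissibleAll-use σ t x ts κ =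
  regroup (admissible σ t x) (admissibleAll σ ts κ) (compatibleWith t x ts κ) (pairwise ts κ)
  where
  regroup : ∀ a b c d → a ∧ ((b ∧ c) ∧ d) ≡ (a ∧ b) ∧ (c ∧ d)
  regroup true  true  c d = refl
  regroup true  false c d = refl
  regroup false b     c d = refl

admissibleAll-none : ∀ (ts : Vec Part k) κ → admissibleAll none ts κ ≡ true
admissibleAll-none []       []      = refl
admissibleAll-none (t ∷ ts) (x ∷ κ) = admissibleAll-none ts κ

properᵇ≡greedy : ∀ l m n κ → properᵇ (Σ l m n) κ ≡ greedy none (parts l m n) κ
properᵇ≡greedy l m n κ = begin
  properᵇ (Σ l m n) κ   ≡⟨ properᵇ≡proper (Σ l m n) κ ⟩
  proper (Σ l m n) κ    ≡⟨ proper-cong κ (Σ-labelled l m n) ⟩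
  proper (labelled (parts l m n)) κ          ≡⟨ proper-labelled (parts l m n) κ ⟩
  pairwise (parts l m n) κ                   ≡⟨ cong (_∧ pairwise (parts l m n) κ) (admissibleAll-none (parts l m n) κ) ⟨
  admissibleAll none (parts l m n) κ ∧ pairwise (parts l m n) κ
                                             ≡⟨ greedy≡admissibleAll∧pairwise none (parts l m n) κ ⟨
  greedy none (parts l m n) κ                ∎
  where open ≡-Reasoning

-- Counting colourings block by block

fall-suc : ∀ u n → fall u (suc n) ≡ u * fall (u - 1ℤ) n
fall-suc u zero    = trans (ℤ.*-identityˡ (u - 0ℤ)) (trans (ℤ.+-identityʳ u) (sym (ℤ.*-identityʳ u)))
fall-suc u (suc n) = begin
  fall u (suc n) * (u - + suc n)            ≡⟨ cong₂ (λ a b → a * (u - b)) (fall-suc u n) (ℤ.pos-+ 1 n) ⟩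
  u * fall (u - 1ℤ) n * (u - (1ℤ + + n))    ≡⟨ regroup u (fall (u - 1ℤ) n) (+ n) ⟩
  u * (fall (u - 1ℤ) n * (u - 1ℤ - + n))    ∎
  where
  open ≡-Reasoning
  regroup : ∀ u F n → u * F * (u - (1ℤ + n)) ≡ u * (F * (u - 1ℤ - n))
  regroup = solve-∀

𝟙-*-cong : ∀ b {v w} → (b ≡ true → v ≡ w) → 𝟙 b * v ≡ 𝟙 b * w
𝟙-*-cong true  v≡w = cong (1ℤ *_) (v≡w refl)
𝟙-*-cong false {v} {w} _ = trans (ℤ.*-zeroˡ v) (sym (ℤ.*-zeroˡ w))

used unused : Seen → ℤ → Bool
used σ y = σ L y ∨ σ M y ∨ σ N y
unused σ y = not (used σ y)

used-use-≢ : ∀ σ t {x y} → y ≢ x → used (use σ t x) y ≡ used σ y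
used-use-≢ σ L {x} {y} y≢x rewrite ⌊⌋-no (y ℤ.≟ x) y≢x = refl
used-use-≢ σ M {x} {y} y≢x rewrite ⌊⌋-no (y ℤ.≟ x) y≢x = refl
used-use-≢ σ N {x} {y} y≢x rewrite ⌊⌋-no (y ℤ.≟ x) y≢x = refl

used-use-≡ : ∀ σ t x → used (use σ t x) x ≡ true
used-use-≡ σ L x rewrite ⌊⌋-yes (x ℤ.≟ x) refl = refl
used-use-≡ σ M x rewrite ⌊⌋-yes (x ℤ.≟ x) refl = Bool.∨-zeroʳ (σ L x)
used-use-≡ σ N x rewrite ⌊⌋-yes (x ℤ.≟ x) refl = trans (cong (σ L x ∨_) (Bool.∨-zeroʳ (σ M x))) (Bool.∨-zeroʳ (σ L x))

-- s, r: admissible colours for the next M vertex that are already used / unused; u: unused colours.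
colouringsMN : ℕ → ℕ → ℤ → ℤ → ℤ → ℤ
colouringsMN n zero    s r u = fall u n
colouringsMN n (suc m) s r u = s * colouringsMN n m (s - 1ℤ) r u + r * colouringsMN n m s (r - 1ℤ) (u - 1ℤ)

-- u, s, r, z play the roles of unusedL, halfPairs, freePairs, zeroFree below.
colouringsLMN : ℕ → ℕ → ℕ → ℤ → ℤ → ℤ → ℤ → ℤ
colouringsLMN n m zero    u s r z = colouringsMN n m s (r + z) u
colouringsLMN n m (suc l) u s r z =
  s * colouringsLMN n m l (u - 1ℤ) (s - 1ℤ) r z
  + r * colouringsLMN n m l (u - 1ℤ) (s + 1ℤ) (r - + 2) z
  + z * colouringsLMN n m l (u - 1ℤ) s r (z - 1ℤ)

module Colourings (Cs : List ℤ) (unique : Unique Cs) (symmetric : map -_ Cs ↭ Cs) where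

  colourings : Seen → Vec Part k → ℤ
  colourings {k} σ ts = count (greedy σ ts) (allVecs Cs k)

  colourings-∷ : ∀ σ t (ts : Vec Part k) →
    colourings σ (t ∷ ts) ≡ ∑[ x ∈ Cs ] (𝟙 (admissible σ t x) * colourings (use σ t x) ts)
  colourings-∷ {k} σ t ts =
    trans (count-concatMap (greedy σ (t ∷ ts)) (λ x → map (x ∷_) (allVecs Cs k)) Cs)
          (∑-cong-∈ Cs λ {x} _ → trans (count-map (greedy σ (t ∷ ts)) (x ∷_) (allVecs Cs k))
                                        (count-∧ˡ (admissible σ t x) (greedy (use σ t x) ts) (allVecs Cs k)))

  neg-∈ : ∀ {x} → x ∈ Cs → - x ∈ Cs
  neg-∈ x∈Cs = ↭.∈-resp-↭ symmetric (∈-map⁺ -_ x∈Cs)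

  count-neg : ∀ (p : ℤ → Bool) → count (λ y → p (- y)) Cs ≡ count p Cs
  count-neg p = trans (sym (count-map p -_ Cs)) (count-↭ p symmetric)

  count-remove : ∀ {p p′ : ℤ → Bool} {x} → x ∈ Cs → (∀ y → y ≢ x → p′ y ≡ p y) → p′ x ≡ false →
                 count p′ Cs ≡ count p Cs - 𝟙 (p x)
  count-remove {p} {p′} {x} x∈Cs agree p′x≡false =
    trans (count-update unique x∈Cs agree) (trans (cong (λ b → count p Cs - 𝟙 (p x) + 𝟙 b) p′x≡false) (ℤ.+-identityʳ _))

  available : Seen → ℤ
  available σ = count (unused σ) Cs

  available-use : ∀ σ t {x} → x ∈ Cs → available (use σ t x) ≡ available σ - 𝟙 (unused σ x)
  available-use σ t x∈Cs = count-remove x∈Cs (λ y y≢x → cong not (used-use-≢ σ t y≢x)) (cong not (used-use-≡ σ t _))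

  colourings-N : ∀ n σ → colourings σ (replicate n N) ≡ fall (available σ) n
  colourings-N zero    σ = refl
  colourings-N (suc n) σ = begin
    colourings σ (N ∷ replicate n N)
      ≡⟨ colourings-∷ σ N (replicate n N) ⟩
    ∑[ x ∈ Cs ] (𝟙 (unused σ x) * colourings (use σ N x) (replicate n N))
      ≡⟨ ∑-cong-∈ Cs (λ x∈Cs → 𝟙-*-cong (unused σ _) λ x-unused →
           trans (colourings-N n _) (cong (λ u → fall u n) (trans (available-use σ N x∈Cs) (cong (λ b → U - 𝟙 b) x-unused)))) ⟩
    ∑[ x ∈ Cs ] (𝟙 (unused σ x) * fall (U - 1ℤ) n)
      ≡⟨ ∑-𝟙 (unused σ) (fall (U - 1ℤ) n) Cs ⟩
    U * fall (U - 1ℤ) n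
      ≡⟨ fall-suc U n ⟨
    fall U (suc n) ∎
    where
    open ≡-Reasoning
    U = available σ

  reusable fresh : Seen → ℤ
  reusable σ = count (λ y → admissible σ M y ∧ used σ y) Cs
  fresh    σ = count (λ y → admissible σ M y ∧ unused σ y) Cs

  admissibleM-use-≢ : ∀ σ {x y} → y ≢ x → admissible (use σ M x) M y ≡ admissible σ M y
  admissibleM-use-≢ σ {x} {y} y≢x =
    trans (admissible-use σ M x M y) (trans (cong (λ b → admissible σ M y ∧ not b) (⌊⌋-no (x ℤ.≟ y) (y≢x ∘ sym))) (Bool.∧-identityʳ _))

  admissibleM-use-≡ : ∀ σ x → admissible (use σ M x) M x ≡ false
  admissibleM-use-≡ σ x =
    trans (admissible-use σ M x M x) (trans (cong (λ b → admissible σ M x ∧ not b) (⌊⌋-yes (x ℤ.≟ x) refl)) (Bool.∧-zeroʳ _))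

  reusable-use : ∀ σ {x} → x ∈ Cs → reusable (use σ M x) ≡ reusable σ - 𝟙 (admissible σ M x ∧ used σ x)
  reusable-use σ {x} x∈Cs = count-remove x∈Cs (λ y y≢x → cong₂ _∧_ (admissibleM-use-≢ σ y≢x) (used-use-≢ σ M y≢x))
                                              (cong (_∧ used (use σ M x) x) (admissibleM-use-≡ σ x))

  fresh-use : ∀ σ {x} → x ∈ Cs → fresh (use σ M x) ≡ fresh σ - 𝟙 (admissible σ M x ∧ unused σ x)
  fresh-use σ {x} x∈Cs = count-remove x∈Cs (λ y y≢x → cong₂ _∧_ (admissibleM-use-≢ σ y≢x) (cong not (used-use-≢ σ M y≢x)))
                                           (cong (_∧ unused (use σ M x) x) (admissibleM-use-≡ σ x))

  colourings-MN : ∀ n m σ → colourings σ (replicate m M Vec.++ replicate n N) ≡ colouringsMN n m (reusable σ) (fresh σ) (available σ)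
  colourings-MN n zero    σ = colourings-N n σ
  colourings-MN n (suc m) σ = begin
    colourings σ (M ∷ rest)
      ≡⟨ colourings-∷ σ M rest ⟩
    ∑[ x ∈ Cs ] (𝟙 (admissible σ M x) * colourings (use σ M x) rest)
      ≡⟨ ∑-cong-∈ Cs (λ {x} x∈Cs → trans (cong (𝟙 (admissible σ M x) *_) (colourings-MN n m (use σ M x))) (choose x∈Cs)) ⟩
    ∑[ x ∈ Cs ] (𝟙 (reuses x) * V₁ + 𝟙 (renews x) * V₂)
      ≡⟨ ∑-+ (λ x → 𝟙 (reuses x) * V₁) (λ x → 𝟙 (renews x) * V₂) Cs ⟩
    ∑[ x ∈ Cs ] (𝟙 (reuses x) * V₁) + ∑[ x ∈ Cs ] (𝟙 (renews x) * V₂)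
      ≡⟨ cong₂ _+_ (∑-𝟙 reuses V₁ Cs) (∑-𝟙 renews V₂ Cs) ⟩
    S * V₁ + R * V₂ ∎
    where
    open ≡-Reasoning
    rest = replicate m M Vec.++ replicate n N
    S = reusable σ
    R = fresh σ
    U = available σ
    V₁ = colouringsMN n m (S - 1ℤ) R U
    V₂ = colouringsMN n m S (R - 1ℤ) (U - 1ℤ)
    reuses renews : ℤ → Bool
    reuses x = admissible σ M x ∧ used σ x
    renews x = admissible σ M x ∧ unused σ x
    choose : ∀ {x} → x ∈ Cs →
      𝟙 (admissible σ M x) * colouringsMN n m (reusable (use σ M x)) (fresh (use σ M x)) (available (use σ M x))
        ≡ 𝟙 (reuses x) * V₁ + 𝟙 (renews x) * V₂
    choose {x} x∈Cs = pick (admissible σ M x) (used σ x) refl refl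
      where
      parameters : ∀ a c → admissible σ M x ≡ a → used σ x ≡ c →
        colouringsMN n m (reusable (use σ M x)) (fresh (use σ M x)) (available (use σ M x))
          ≡ colouringsMN n m (S - 𝟙 (a ∧ c)) (R - 𝟙 (a ∧ not c)) (U - 𝟙 (not c))
      parameters a c refl refl = cong₃ (colouringsMN n m) (reusable-use σ x∈Cs) (fresh-use σ x∈Cs) (available-use σ M x∈Cs)
      only₀ : ∀ a b c → 0ℤ * a ≡ 0ℤ * b + 0ℤ * c
      only₀ = solve-∀
      only₁ : ∀ b c → 1ℤ * b ≡ 1ℤ * b + 0ℤ * c
      only₁ = solve-∀
      only₂ : ∀ b c → 1ℤ * c ≡ 0ℤ * b + 1ℤ * c
      only₂ = solve-∀
      pick : ∀ a c → admissible σ M x ≡ a → used σ x ≡ c →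
        𝟙 a * colouringsMN n m (reusable (use σ M x)) (fresh (use σ M x)) (available (use σ M x))
          ≡ 𝟙 (a ∧ c) * V₁ + 𝟙 (a ∧ not c) * V₂
      pick false c _ _ = only₀ (colouringsMN n m (reusable (use σ M x)) (fresh (use σ M x)) (available (use σ M x))) V₁ V₂
      pick true true  a≡ c≡ = trans (cong (1ℤ *_) (trans (parameters true true a≡ c≡)
                                 (cong₂ (λ r u → colouringsMN n m (S - 1ℤ) r u) (ℤ.+-identityʳ R) (ℤ.+-identityʳ U))))
                               (only₁ V₁ V₂)
      pick true false a≡ c≡ = trans (cong (1ℤ *_) (trans (parameters true false a≡ c≡)
                                 (cong (λ s → colouringsMN n m s (R - 1ℤ) (U - 1ℤ)) (ℤ.+-identityʳ S))))
                               (only₂ V₁ V₂)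

  isZero : ℤ → Bool
  isZero y = ⌊ y ℤ.≟ 0ℤ ⌋

  insert-≢ : ∀ {x y} (A : ℤ → Bool) → y ≢ x → insert x A y ≡ A y
  insert-≢ {x} {y} A y≢x = cong (_∨ A y) (⌊⌋-no (y ℤ.≟ x) y≢x)

  insert-≡ : ∀ x (A : ℤ → Bool) → insert x A x ≡ true
  insert-≡ x A = cong (_∨ A x) (⌊⌋-yes (x ℤ.≟ x) refl)

  neg-≢ : ∀ {x y} → y ≢ - x → - y ≢ x
  neg-≢ {x} {y} y≢-x -y≡x = y≢-x (trans (sym (ℤ.neg-involutive y)) (cong -_ -y≡x))

  neg-≢-self : ∀ {x} → x ≢ 0ℤ → - x ≢ x
  neg-≢-self {+ zero}    x≢0 _  = x≢0 refl
  neg-≢-self {+ suc n}   _   ()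
  neg-≢-self { ℤ.-[1+ n ]} _ ()

  count-insert₁ : ∀ (φ : ℤ → Bool → Bool) {A x} → x ∈ Cs →
    count (λ y → φ y (insert x A y)) Cs ≡ count (λ y → φ y (A y)) Cs - 𝟙 (φ x (A x)) + 𝟙 (φ x true)
  count-insert₁ φ {A} {x} x∈Cs =
    trans (count-update unique x∈Cs λ y y≢x → cong (φ y) (insert-≢ A y≢x))
          (cong (λ b → count (λ y → φ y (A y)) Cs - 𝟙 (φ x (A x)) + 𝟙 (φ x b)) (insert-≡ x A))

  -- Inserting x ≠ 0 changes the predicate at x and at -x; updating the first argument before the second separates the two.
  count-insert₂ : ∀ (φ : ℤ → Bool → Bool → Bool) {A x} → x ∈ Cs → x ≢ 0ℤ →
    count (λ y → φ y (insert x A y) (insert x A (- y))) Cs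
      ≡ count (λ y → φ y (A y) (A (- y))) Cs - 𝟙 (φ x (A x) (A (- x))) + 𝟙 (φ x true (A (- x)))
                                             - 𝟙 (φ (- x) (A (- x)) (A x)) + 𝟙 (φ (- x) (A (- x)) true)
  count-insert₂ φ {A} {x} x∈Cs x≢0 = begin
    count (λ y → φ y (insert x A y) (insert x A (- y))) Cs
      ≡⟨ count-update unique (neg-∈ x∈Cs) (λ y y≢-x → cong (φ y (insert x A y)) (insert-≢ A (neg-≢ y≢-x))) ⟩
    count half Cs - 𝟙 (half (- x)) + 𝟙 (φ (- x) (insert x A (- x)) (insert x A (- - x)))
      ≡⟨ cong₂ (λ c e → c - 𝟙 (half (- x)) + e) first (cong 𝟙 last) ⟩
    count (λ y → φ y (A y) (A (- y))) Cs - 𝟙 (φ x (A x) (A (- x))) + 𝟙 (φ x true (A (- x)))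
      - 𝟙 (half (- x)) + 𝟙 (φ (- x) (A (- x)) true)
      ≡⟨ cong (λ h → before - 𝟙 h + 𝟙 (φ (- x) (A (- x)) true)) middle ⟩
    count (λ y → φ y (A y) (A (- y))) Cs - 𝟙 (φ x (A x) (A (- x))) + 𝟙 (φ x true (A (- x)))
      - 𝟙 (φ (- x) (A (- x)) (A x)) + 𝟙 (φ (- x) (A (- x)) true) ∎
    where
    open ≡-Reasoning
    half : ℤ → Bool
    half y = φ y (insert x A y) (A (- y))
    before : ℤ
    before = count (λ y → φ y (A y) (A (- y))) Cs - 𝟙 (φ x (A x) (A (- x))) + 𝟙 (φ x true (A (- x)))
    first : count half Cs ≡ count (λ y → φ y (A y) (A (- y))) Cs - 𝟙 (φ x (A x) (A (- x))) + 𝟙 (φ x true (A (- x)))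
    first = count-insert₁ (λ y a → φ y a (A (- y))) x∈Cs
    last : φ (- x) (insert x A (- x)) (insert x A (- - x)) ≡ φ (- x) (A (- x)) true
    last = cong₂ (φ (- x)) (insert-≢ A (neg-≢-self x≢0)) (trans (cong (insert x A) (ℤ.neg-involutive x)) (insert-≡ x A))
    middle : half (- x) ≡ φ (- x) (A (- x)) (A x)
    middle = cong₂ (φ (- x)) (insert-≢ A (neg-≢-self x≢0)) (cong A (ℤ.neg-involutive x))

  count-insert₂-zero : ∀ (φ : ℤ → Bool → Bool → Bool) {A} → 0ℤ ∈ Cs →
    count (λ y → φ y (insert 0ℤ A y) (insert 0ℤ A (- y))) Cs
      ≡ count (λ y → φ y (A y) (A (- y))) Cs - 𝟙 (φ 0ℤ (A 0ℤ) (A 0ℤ)) + 𝟙 (φ 0ℤ true true)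
  count-insert₂-zero φ {A} 0∈Cs = count-update unique 0∈Cs λ y y≢0 →
    cong₂ (φ y) (insert-≢ A y≢0) (insert-≢ A (neg-≢ y≢0))

  unusedL halfPairs freePairs zeroFree : (ℤ → Bool) → ℤ
  unusedL   A = count (λ y → not (A y)) Cs
  halfPairs A = count (λ y → A y ∧ not (A (- y))) Cs
  freePairs A = count (λ y → not (isZero y) ∧ (not (A y) ∧ not (A (- y)))) Cs
  zeroFree  A = count (λ y → isZero y ∧ not (A y)) Cs

  module _ {A : ℤ → Bool} {x : ℤ} (x∈Cs : x ∈ Cs) (x∉A : A x ≡ false) where

    unusedL-insert : unusedL (insert x A) ≡ unusedL A - 1ℤ
    unusedL-insert = trans (count-insert₁ (λ _ a → not a) x∈Cs)
                           (trans (cong (λ a → unusedL A - 𝟙 (not a) + 0ℤ) x∉A) (ℤ.+-identityʳ _))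

    zeroFree-insert : zeroFree (insert x A) ≡ zeroFree A - 𝟙 (isZero x)
    zeroFree-insert = begin
      zeroFree (insert x A)
        ≡⟨ count-insert₁ (λ y a → isZero y ∧ not a) x∈Cs ⟩
      zeroFree A - 𝟙 (isZero x ∧ not (A x)) + 𝟙 (isZero x ∧ false)
        ≡⟨ cong₂ (λ a b → zeroFree A - 𝟙 a + 𝟙 b) (trans (cong (λ a → isZero x ∧ not a) x∉A) (Bool.∧-identityʳ _)) (Bool.∧-zeroʳ _) ⟩
      zeroFree A - 𝟙 (isZero x) + 0ℤ
        ≡⟨ ℤ.+-identityʳ _ ⟩
      zeroFree A - 𝟙 (isZero x) ∎
      where open ≡-Reasoning

    halfPairs-insert : x ≢ 0ℤ → ∀ c → A (- x) ≡ c → halfPairs (insert x A) ≡ halfPairs A + 𝟙 (not c) - 𝟙 c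
    halfPairs-insert x≢0 c -x∈A = trans (count-insert₂ (λ _ a b → a ∧ not b) x∈Cs x≢0)
      (trans (cong₂ (λ a c′ → halfPairs A - 𝟙 (a ∧ not c′) + 𝟙 (not c′) - 𝟙 (c′ ∧ not a) + 𝟙 (c′ ∧ false)) x∉A -x∈A) (arith c))
      where
      arith : ∀ c → halfPairs A - 0ℤ + 𝟙 (not c) - 𝟙 (c ∧ true) + 𝟙 (c ∧ false) ≡ halfPairs A + 𝟙 (not c) - 𝟙 c
      arith true  = completes (halfPairs A)
        where
        completes : ∀ S → S - 0ℤ + 0ℤ - 1ℤ + 0ℤ ≡ S + 0ℤ - 1ℤ
        completes = solve-∀
      arith false = opens (halfPairs A)
        where
        opens : ∀ S → S - 0ℤ + 1ℤ - 0ℤ + 0ℤ ≡ S + 1ℤ - 0ℤ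
        opens = solve-∀

    freePairs-insert : x ≢ 0ℤ → ∀ c → A (- x) ≡ c → freePairs (insert x A) ≡ freePairs A - 𝟙 (not c) - 𝟙 (not c)
    freePairs-insert x≢0 c -x∈A = trans (count-insert₂ (λ y a b → not (isZero y) ∧ (not a ∧ not b)) x∈Cs x≢0)
      (trans (cong₄ (λ z z′ a c′ → freePairs A - 𝟙 (not z ∧ (not a ∧ not c′)) + 𝟙 (not z ∧ false)
                                                - 𝟙 (not z′ ∧ (not c′ ∧ not a)) + 𝟙 (not z′ ∧ (not c′ ∧ false)))
                    (⌊⌋-no (x ℤ.≟ 0ℤ) x≢0) (⌊⌋-no (- x ℤ.≟ 0ℤ) (neg-≢ x≢0)) x∉A -x∈A)
             (arith c))
      where
      arith : ∀ c → freePairs A - 𝟙 (not c) + 0ℤ - 𝟙 (not c ∧ true) + 𝟙 (not c ∧ false) ≡ freePairs A - 𝟙 (not c) - 𝟙 (not c)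
      arith true  = completes (freePairs A)
        where
        completes : ∀ R → R - 0ℤ + 0ℤ - 0ℤ + 0ℤ ≡ R - 0ℤ - 0ℤ
        completes = solve-∀
      arith false = opens (freePairs A)
        where
        opens : ∀ R → R - 1ℤ + 0ℤ - 1ℤ + 0ℤ ≡ R - 1ℤ - 1ℤ
        opens = solve-∀

  halfPairs-insert-zero : ∀ {A x} → x ∈ Cs → x ≡ 0ℤ → A x ≡ false → halfPairs (insert x A) ≡ halfPairs A
  halfPairs-insert-zero {A} 0∈Cs refl 0∉A = trans (count-insert₂-zero (λ _ a b → a ∧ not b) 0∈Cs)
    (trans (cong (λ a → halfPairs A - 𝟙 (a ∧ not a) + 0ℤ) 0∉A) (unchanged (halfPairs A)))
    where
    unchanged : ∀ S → S - 0ℤ + 0ℤ ≡ S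
    unchanged = solve-∀

  freePairs-insert-zero : ∀ {A x} → x ∈ Cs → x ≡ 0ℤ → freePairs (insert x A) ≡ freePairs A
  freePairs-insert-zero {A} 0∈Cs refl = trans (count-insert₂-zero (λ y a b → not (isZero y) ∧ (not a ∧ not b)) 0∈Cs)
                                         (unchanged (freePairs A))
    where
    unchanged : ∀ R → R - 0ℤ + 0ℤ ≡ R
    unchanged = solve-∀

  isZero-true : ∀ {x} → isZero x ≡ true → x ≡ 0ℤ
  isZero-true {x} z with x ℤ.≟ 0ℤ
  ... | yes x≡0 = x≡0

  isZero-false : ∀ {x} → isZero x ≡ false → x ≢ 0ℤ
  isZero-false {x} z x≡0 with () ← trans (sym z) (⌊⌋-yes (x ℤ.≟ 0ℤ) x≡0)

  colourings-LMN : ∀ n m l σ → (∀ y → σ M y ≡ false) → (∀ y → σ N y ≡ false) →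
    colourings σ (parts l m n) ≡ colouringsLMN n m l (unusedL (σ L)) (halfPairs (σ L)) (freePairs (σ L)) (zeroFree (σ L))
  colourings-LMN n m zero σ M-empty N-empty =
    trans (colourings-MN n m σ) (cong₃ (colouringsMN n m) reusable≡ fresh≡ available≡)
    where
    usedL = σ L
    only-L : ∀ y z w → σ L y ∨ σ M z ∨ σ N w ≡ σ L y
    only-L y z w rewrite M-empty z | N-empty w = Bool.∨-identityʳ (σ L y)
    reusable≡ : reusable σ ≡ halfPairs usedL
    reusable≡ = count-cong Cs λ y → trans (cong₂ (λ a b → not a ∧ b) (only-L (- y) y y) (only-L y y y)) (Bool.∧-comm (not (usedL (- y))) (usedL y))
    available≡ : available σ ≡ unusedL usedL
    available≡ = count-cong Cs λ y → cong not (only-L y y y)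
    zero-part : ∀ y → ⌊ y ℤ.≟ 0ℤ ⌋ ∧ (not (usedL (- y)) ∧ not (usedL y)) ≡ ⌊ y ℤ.≟ 0ℤ ⌋ ∧ not (usedL y)
    zero-part y with y ℤ.≟ 0ℤ
    ... | yes refl = Bool.∧-idem _
    ... | no _     = refl
    fresh≡ : fresh σ ≡ freePairs usedL + zeroFree usedL
    fresh≡ = begin
      fresh σ
        ≡⟨ count-cong Cs (λ y → cong₂ (λ a b → not a ∧ not b) (only-L (- y) y y) (only-L y y y)) ⟩
      count (λ y → not (usedL (- y)) ∧ not (usedL y)) Cs
        ≡⟨ count-split isZero _ Cs ⟩
      count (λ y → not (isZero y) ∧ (not (usedL (- y)) ∧ not (usedL y))) Cs + count (λ y → isZero y ∧ (not (usedL (- y)) ∧ not (usedL y))) Cs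
        ≡⟨ cong₂ _+_ (count-cong Cs λ y → cong (not (isZero y) ∧_) (Bool.∧-comm (not (usedL (- y))) (not (usedL y)))) (count-cong Cs zero-part) ⟩
      freePairs usedL + zeroFree usedL ∎
      where open ≡-Reasoning
  colourings-LMN n m (suc l) σ M-empty N-empty = begin
    colourings σ (L ∷ rest)
      ≡⟨ colourings-∷ σ L rest ⟩
    ∑[ x ∈ Cs ] (𝟙 (admissible σ L x) * colourings (use σ L x) rest)
      ≡⟨ ∑-cong-∈ Cs (λ {x} x∈Cs → trans (cong₂ _*_ (cong 𝟙 (admissibleL x)) (colourings-LMN n m l (use σ L x) M-empty N-empty))
                                         (choose x∈Cs)) ⟩
    ∑[ x ∈ Cs ] (𝟙 (completes x) * V₁ + 𝟙 (opens x) * V₂ + 𝟙 (takesZero x) * V₃)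
      ≡⟨ trans (∑-+ _ _ Cs) (cong (_+ ∑[ x ∈ Cs ] (𝟙 (takesZero x) * V₃)) (∑-+ _ _ Cs)) ⟩
    ∑[ x ∈ Cs ] (𝟙 (completes x) * V₁) + ∑[ x ∈ Cs ] (𝟙 (opens x) * V₂) + ∑[ x ∈ Cs ] (𝟙 (takesZero x) * V₃)
      ≡⟨ cong₃ (λ a b c → a + b + c) (trans (∑-𝟙 completes V₁ Cs) (cong (_* V₁) completes≡)) (∑-𝟙 opens V₂ Cs) (∑-𝟙 takesZero V₃ Cs) ⟩
    S * V₁ + R * V₂ + Z * V₃ ∎
    where
    open ≡-Reasoning
    rest = (replicate l L Vec.++ replicate m M) Vec.++ replicate n N
    usedL = σ L
    U = unusedL usedL
    S = halfPairs usedL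
    R = freePairs usedL
    Z = zeroFree usedL
    V₁ = colouringsLMN n m l (U - 1ℤ) (S - 1ℤ) R Z
    V₂ = colouringsLMN n m l (U - 1ℤ) (S + 1ℤ) (R - + 2) Z
    V₃ = colouringsLMN n m l (U - 1ℤ) S R (Z - 1ℤ)
    completes opens takesZero : ℤ → Bool
    completes x = not (usedL x) ∧ usedL (- x)
    opens     x = not (isZero x) ∧ (not (usedL x) ∧ not (usedL (- x)))
    takesZero x = isZero x ∧ not (usedL x)
    admissibleL : ∀ x → admissible σ L x ≡ not (usedL x)
    admissibleL x rewrite M-empty (- x) | N-empty x = cong not (Bool.∨-identityʳ (usedL x))
    completes≡ : count completes Cs ≡ S
    completes≡ = trans (count-cong Cs λ y → trans (Bool.∧-comm (not (usedL y)) (usedL (- y))) (cong (λ a → usedL (- y) ∧ not a) (sym (cong usedL (ℤ.neg-involutive y)))))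
                       (count-neg (λ y → usedL y ∧ not (usedL (- y))))
    choose : ∀ {x} → x ∈ Cs →
      𝟙 (not (usedL x)) * colouringsLMN n m l (unusedL (insert x usedL)) (halfPairs (insert x usedL)) (freePairs (insert x usedL)) (zeroFree (insert x usedL))
        ≡ 𝟙 (completes x) * V₁ + 𝟙 (opens x) * V₂ + 𝟙 (takesZero x) * V₃
    choose {x} x∈Cs = pick (usedL x) (isZero x) (usedL (- x)) refl refl refl
      where
      Φ : ℤ
      Φ = colouringsLMN n m l (unusedL (insert x usedL)) (halfPairs (insert x usedL)) (freePairs (insert x usedL)) (zeroFree (insert x usedL))
      no-choice : ∀ a b c → 0ℤ * Φ ≡ 0ℤ * a + 0ℤ * b + 0ℤ * c
      no-choice a b c = trans (ℤ.*-zeroˡ Φ) (zeros a b c)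
        where
        zeros : ∀ a b c → 0ℤ ≡ 0ℤ * a + 0ℤ * b + 0ℤ * c
        zeros = solve-∀
      first : ∀ a b c → 1ℤ * a ≡ 1ℤ * a + 0ℤ * b + 0ℤ * c
      first = solve-∀
      second : ∀ a b c → 1ℤ * b ≡ 0ℤ * a + 1ℤ * b + 0ℤ * c
      second = solve-∀
      third : ∀ a b c → 1ℤ * c ≡ 0ℤ * a + 0ℤ * b + 1ℤ * c
      third = solve-∀
      minus-zero : ∀ v → v - 0ℤ ≡ v
      minus-zero = ℤ.+-identityʳ
      zeroFree-insert-≢0 : isZero x ≡ false → usedL x ≡ false → zeroFree (insert x usedL) ≡ Z
      zeroFree-insert-≢0 z x∉usedL = trans (zeroFree-insert x∈Cs x∉usedL) (trans (cong (λ b → Z - 𝟙 b) z) (minus-zero Z))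
      pick : ∀ a z c → usedL x ≡ a → isZero x ≡ z → usedL (- x) ≡ c →
        𝟙 (not a) * Φ ≡ 𝟙 (not a ∧ c) * V₁ + 𝟙 (not z ∧ (not a ∧ not c)) * V₂ + 𝟙 (z ∧ not a) * V₃
      pick true  true  c _ _ _ = no-choice V₁ V₂ V₃
      pick true  false c _ _ _ = no-choice V₁ V₂ V₃
      pick false true  true  x∉usedL z -x∈usedL with () ← trans (sym -x∈usedL) (trans (cong usedL (trans (cong -_ (isZero-true z)) (sym (isZero-true z)))) x∉usedL)
      pick false true  false x∉usedL z _ = trans (cong (1ℤ *_) Φ≡V₃) (third V₁ V₂ V₃)
        where
        Φ≡V₃ : Φ ≡ V₃
        Φ≡V₃ = cong₄ (colouringsLMN n m l) (unusedL-insert x∈Cs x∉usedL)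
                     (halfPairs-insert-zero x∈Cs (isZero-true z) x∉usedL) (freePairs-insert-zero x∈Cs (isZero-true z))
                     (trans (zeroFree-insert x∈Cs x∉usedL) (cong (λ b → Z - 𝟙 b) z))
      pick false false true  x∉usedL z -x∈usedL = trans (cong (1ℤ *_) Φ≡V₁) (first V₁ V₂ V₃)
        where
        Φ≡V₁ : Φ ≡ V₁
        Φ≡V₁ = cong₄ (colouringsLMN n m l) (unusedL-insert x∈Cs x∉usedL)
                     (trans (halfPairs-insert x∈Cs x∉usedL (isZero-false z) true -x∈usedL) (cong (_- 1ℤ) (ℤ.+-identityʳ S)))
                     (trans (freePairs-insert x∈Cs x∉usedL (isZero-false z) true -x∈usedL) (trans (minus-zero (R - 0ℤ)) (minus-zero R)))
                     (zeroFree-insert-≢0 z x∉usedL)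
      pick false false false x∉usedL z -x∉usedL = trans (cong (1ℤ *_) Φ≡V₂) (second V₁ V₂ V₃)
        where
        two : ∀ R → R - 1ℤ - 1ℤ ≡ R - + 2
        two = solve-∀
        Φ≡V₂ : Φ ≡ V₂
        Φ≡V₂ = cong₄ (colouringsLMN n m l) (unusedL-insert x∈Cs x∉usedL)
                     (trans (halfPairs-insert x∈Cs x∉usedL (isZero-false z) false -x∉usedL) (minus-zero (S + 1ℤ)))
                     (trans (freePairs-insert x∈Cs x∉usedL (isZero-false z) false -x∉usedL) (two R))
                     (zeroFree-insert-≢0 z x∉usedL)

∑< : ℕ → (ℕ → ℤ) → ℤ
∑< zero    f = 0ℤ
∑< (suc n) f = ∑< n f + f n

syntax ∑< n (λ j → e) = ∑[ j < n ] e

∑<-cong : ∀ n {f g : ℕ → ℤ} → (∀ j → j < n → f j ≡ g j) → ∑< n f ≡ ∑< n g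
∑<-cong zero    eq = refl
∑<-cong (suc n) eq = cong₂ _+_ (∑<-cong n λ j j<n → eq j (ℕ.m<n⇒m<1+n j<n)) (eq n ℕ.≤-refl)

∑<-suc : ∀ n (f : ℕ → ℤ) → ∑< (suc n) f ≡ f 0 + ∑[ j < n ] f (suc j)
∑<-suc zero    f = ℤ.+-comm 0ℤ (f 0)
∑<-suc (suc n) f = trans (cong (_+ f (suc n)) (∑<-suc n f)) (ℤ.+-assoc (f 0) _ _)

∑<-+ : ∀ n (f g : ℕ → ℤ) → ∑[ j < n ] (f j + g j) ≡ ∑< n f + ∑< n g
∑<-+ zero    f g = refl
∑<-+ (suc n) f g = trans (cong (_+ (f n + g n)) (∑<-+ n f g)) (+-interchange (∑< n f) (∑< n g) (f n) (g n))

*-∑< : ∀ n c (f : ℕ → ℤ) → c * ∑< n f ≡ ∑[ j < n ] (c * f j)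
*-∑< zero    c f = ℤ.*-zeroʳ c
*-∑< (suc n) c f = trans (ℤ.*-distribˡ-+ c (∑< n f) (f n)) (cong (_+ c * f n) (*-∑< n c f))

∑<-zero : ∀ n (f : ℕ → ℤ) → (∀ j → j < n → f j ≡ 0ℤ) → ∑< n f ≡ 0ℤ
∑<-zero n f f≡0 = trans (∑<-cong n f≡0) (zeros n)
  where
  zeros : ∀ n → ∑[ j < n ] 0ℤ ≡ 0ℤ
  zeros zero    = refl
  zeros (suc n) = cong (_+ 0ℤ) (zeros n)

∑<-extend : ∀ {a b} (f : ℕ → ℤ) → a ≤ b → (∀ j → a ≤ j → j < b → f j ≡ 0ℤ) → ∑< b f ≡ ∑< a f
∑<-extend f a≤b f≡0 with ℕ.m≤n⇒m<n∨m≡n a≤b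
... | inj₂ refl = refl
∑<-extend {b = suc b} f _ f≡0 | inj₁ (s≤s a≤b) =
  trans (cong₂ _+_ (∑<-extend f a≤b λ j a≤j j<b → f≡0 j a≤j (ℕ.m<n⇒m<1+n j<b)) (f≡0 b a≤b ℕ.≤-refl)) (ℤ.+-identityʳ _)

∑<-comm : ∀ a b (f : ℕ → ℕ → ℤ) → ∑[ i < a ] ∑[ j < b ] f i j ≡ ∑[ j < b ] ∑[ i < a ] f i j
∑<-comm zero    b f = sym (∑<-zero b _ λ _ _ → refl)
∑<-comm (suc a) b f = trans (cong (_+ ∑[ j < b ] f a j) (∑<-comm a b f)) (sym (∑<-+ b (λ j → ∑[ i < a ] f i j) (f a)))

Σ[0≤]≡∑< : ∀ n (g : ℕ → ℤ) → (Σ[0≤ n ] g) ≡ ∑< (suc n) g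
Σ[0≤]≡∑< n g = shifted (suc n) (λ j → j)
  where
  shifted : ∀ n (h : ℕ → ℕ) → foldr _+_ 0ℤ (map g (applyUpTo h n)) ≡ ∑[ j < n ] g (h j)
  shifted zero    h = refl
  shifted (suc n) h = trans (cong (_+_ (g (h 0))) (shifted n (h ∘′ suc))) (sym (∑<-suc n (g ∘′ h)))

+-∸ : ∀ {m n} → n ≤ m → + (m ∸ n) ≡ + m - + n
+-∸ {m} {n} n≤m = sym (trans (ℤ.[+m]-[+n]≡m⊖n m n) (ℤ.⊖-≥ n≤m))

fall-pascal : ∀ u n → fall (u + 1ℤ) (suc n) ≡ fall u (suc n) + + suc n * fall u n
fall-pascal u zero    = base u
  where
  base : ∀ u → 1ℤ * (u + 1ℤ - 0ℤ) ≡ 1ℤ * (u - 0ℤ) + 1ℤ * 1ℤ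
  base = solve-∀
fall-pascal u (suc k) = trans (cong (_* (u + 1ℤ - + suc k)) (fall-pascal u k)) (step (fall u k) u (+ k))
  where
  step : ∀ F u K → (F * (u - K) + (1ℤ + K) * F) * (u + 1ℤ - (1ℤ + K))
                   ≡ F * (u - K) * (u - (1ℤ + K)) + (1ℤ + (1ℤ + K)) * (F * (u - K))
  step = solve-∀

fall-split : ∀ y a b → fall y (a ℕ.+ b) ≡ fall y a * fall (y - + a) b
fall-split y a zero    = trans (cong (fall y) (ℕ.+-identityʳ a)) (sym (ℤ.*-identityʳ _))
fall-split y a (suc b) = begin
  fall y (a ℕ.+ suc b)                                 ≡⟨ cong (fall y) (ℕ.+-suc a b) ⟩
  fall y (a ℕ.+ b) * (y - + (a ℕ.+ b))                 ≡⟨ cong₂ (λ f c → f * (y - c)) (fall-split y a b) (ℤ.pos-+ a b) ⟩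
  fall y a * fall (y - + a) b * (y - (+ a + + b))      ≡⟨ regroup (fall y a) (fall (y - + a) b) y (+ a) (+ b) ⟩
  fall y a * (fall (y - + a) b * (y - + a - + b))      ∎
  where
  open ≡-Reasoning
  regroup : ∀ F G y A B → F * G * (y - (A + B)) ≡ F * (G * (y - A - B))
  regroup = solve-∀

fall₂-split : ∀ y a b → fall₂ y (a ℕ.+ b) ≡ fall₂ y a * fall₂ (y - + (2 ℕ.* a)) b
fall₂-split y a zero    = trans (cong (fall₂ y) (ℕ.+-identityʳ a)) (sym (ℤ.*-identityʳ _))
fall₂-split y a (suc b) = begin
  fall₂ y (a ℕ.+ suc b)                                           ≡⟨ cong (fall₂ y) (ℕ.+-suc a b) ⟩
  fall₂ y (a ℕ.+ b) * (y - + (2 ℕ.* (a ℕ.+ b)))                   ≡⟨ cong₂ (λ f c → f * (y - c)) (fall₂-split y a b)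
                                                                        (trans (cong +_ (ℕ.*-distribˡ-+ 2 a b)) (ℤ.pos-+ (2 ℕ.* a) (2 ℕ.* b))) ⟩
  fall₂ y a * fall₂ y′ b * (y - (+ (2 ℕ.* a) + + (2 ℕ.* b)))      ≡⟨ regroup (fall₂ y a) (fall₂ y′ b) y (+ (2 ℕ.* a)) (+ (2 ℕ.* b)) ⟩
  fall₂ y a * (fall₂ y′ b * (y′ - + (2 ℕ.* b)))                   ∎
  where
  open ≡-Reasoning
  y′ = y - + (2 ℕ.* a)
  regroup : ∀ F G y A B → F * G * (y - (A + B)) ≡ F * (G * (y - A - B))
  regroup = solve-∀

fall-zero : ∀ {n k} → n < k → fall (+ n) k ≡ 0ℤ
fall-zero {n} {suc k} n<1+k with ℕ.m≤n⇒m<n∨m≡n (ℕ.≤-pred n<1+k)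
... | inj₁ n<k  = trans (cong (_* (+ n - + k)) (fall-zero n<k)) (ℤ.*-zeroˡ (+ n - + k))
... | inj₂ refl = trans (cong (fall (+ n) n *_) (ℤ.+-inverseʳ (+ n))) (ℤ.*-zeroʳ (fall (+ n) n))

fallℕ≡fall : ∀ n k → + fallℕ n k ≡ fall (+ n) k
fallℕ≡fall n zero    = refl
fallℕ≡fall n (suc k) with ℕ.≤-<-connex k n
... | inj₁ k≤n = trans (ℤ.pos-* (fallℕ n k) (n ∸ k)) (cong₂ _*_ (fallℕ≡fall n k) (+-∸ k≤n))
... | inj₂ n<k = trans (cong +_ (trans (cong (fallℕ n k ℕ.*_) (ℕ.m≤n⇒m∸n≡0 (ℕ.<⇒≤ n<k))) (ℕ.*-zeroʳ (fallℕ n k))))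
                       (sym (fall-zero (ℕ.m<n⇒m<1+n n<k)))

factorial-choose : ∀ n k → + (k ! ℕ.* (n C k)) ≡ fall (+ n) k
factorial-choose n       zero    = refl
factorial-choose zero    (suc k) = trans (cong +_ (ℕ.*-zeroʳ (suc k !))) (sym (fall-zero {0} {suc k} (s≤s ℕ.z≤n)))
factorial-choose (suc n) (suc k) = begin
  + (suc k ! ℕ.* (suc n C suc k))
    ≡⟨ cong (λ c → + (suc k ! ℕ.* c)) (nCk+nC[k+1]≡[n+1]C[k+1] n k) ⟨
  + (suc k ! ℕ.* ((n C k) ℕ.+ (n C suc k)))
    ≡⟨ cong +_ (distribute (k !) (n C k) (n C suc k) k) ⟩
  + (suc k ! ℕ.* (n C suc k) ℕ.+ suc k ℕ.* (k ! ℕ.* (n C k)))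
    ≡⟨ trans (ℤ.pos-+ (suc k ! ℕ.* (n C suc k)) _) (cong (_+_ (+ (suc k ! ℕ.* (n C suc k)))) (ℤ.pos-* (suc k) (k ! ℕ.* (n C k)))) ⟩
  + (suc k ! ℕ.* (n C suc k)) + + suc k * + (k ! ℕ.* (n C k))
    ≡⟨ cong₂ (λ a b → a + + suc k * b) (factorial-choose n (suc k)) (factorial-choose n k) ⟩
  fall (+ n) (suc k) + + suc k * fall (+ n) k
    ≡⟨ fall-pascal (+ n) k ⟨
  fall (+ (n ℕ.+ 1)) (suc k)
    ≡⟨ cong (λ v → fall (+ v) (suc k)) (ℕ.+-comm n 1) ⟩
  fall (+ suc n) (suc k) ∎
  where
  open ≡-Reasoning
  distribute : ∀ F a b k → suc k ℕ.* F ℕ.* (a ℕ.+ b) ≡ suc k ℕ.* F ℕ.* b ℕ.+ suc k ℕ.* (F ℕ.* a)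
  distribute = solve-∀ℕ

-- The last of n + 1 vertices is either unmatched, or matched to one of the n − 2k vertices missed by a k-matching of the others.
matchings : ℕ → ℕ → ℕ
matchings n       zero    = 1
matchings zero    (suc k) = 0
matchings (suc n) (suc k) = matchings n (suc k) ℕ.+ (n ∸ 2 ℕ.* k) ℕ.* matchings n k

2*suc : ∀ k → 2 ℕ.* suc k ≡ suc (suc (2 ℕ.* k))
2*suc k = shape k
  where
  shape : ∀ k → 2 ℕ.* (1 ℕ.+ k) ≡ 2 ℕ.+ 2 ℕ.* k
  shape = solve-∀ℕ

matchings-zero : ∀ {n k} → n < 2 ℕ.* k → matchings n k ≡ 0
matchings-zero {n}     {zero}  ()
matchings-zero {zero}  {suc k} _ = refl
matchings-zero {suc n} {suc k} n<2k+2 =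
  cong₂ ℕ._+_ (matchings-zero {n} {suc k} (ℕ.<-trans ℕ.≤-refl n<2k+2)) (cong (ℕ._* matchings n k) (ℕ.m≤n⇒m∸n≡0 n≤2k))
  where
  n≤2k : n ≤ 2 ℕ.* k
  n≤2k = ℕ.≤-pred (ℕ.≤-pred (subst (suc n <_) (2*suc k) n<2k+2))

-- Both sides vanish when n < 2k, so the truncated subtraction n ∸ 2k is harmless.
∸-times-fall : ∀ n k → + (n ∸ 2 ℕ.* k) * fall (+ n) (2 ℕ.* k) ≡ fall (+ n) (2 ℕ.* k) * (+ n - + (2 ℕ.* k))
∸-times-fall n k with ℕ.≤-<-connex (2 ℕ.* k) n
... | inj₁ 2k≤n = trans (ℤ.*-comm (+ (n ∸ 2 ℕ.* k)) (fall (+ n) (2 ℕ.* k))) (cong (fall (+ n) (2 ℕ.* k) *_) (+-∸ 2k≤n))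
... | inj₂ n<2k rewrite fall-zero n<2k = trans (ℤ.*-zeroʳ (+ (n ∸ 2 ℕ.* k))) (sym (ℤ.*-zeroˡ (+ n - + (2 ℕ.* k))))

matchings-fall : ∀ n k → + (matchings n k ℕ.* (2 ℕ.^ k ℕ.* k !)) ≡ fall (+ n) (2 ℕ.* k)
matchings-fall n       zero    = refl
matchings-fall zero    (suc k) = sym (fall-zero {0} {2 ℕ.* suc k} (subst (0 <_) (sym (2*suc k)) (s≤s ℕ.z≤n)))
matchings-fall (suc n) (suc k) = begin
  + ((a₁ ℕ.+ b₁ ℕ.* c₁) ℕ.* (2 ℕ.* p₁ ℕ.* (suc k ℕ.* f₁)))
    ≡⟨ cong +_ (split a₁ b₁ c₁ p₁ f₁ k) ⟩
  + (a₁ ℕ.* (2 ℕ.* p₁ ℕ.* (suc k ℕ.* f₁)) ℕ.+ b₁ ℕ.* (c₁ ℕ.* (p₁ ℕ.* f₁)) ℕ.* (2 ℕ.* suc k))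
    ≡⟨ trans (ℤ.pos-+ (a₁ ℕ.* (2 ℕ.* p₁ ℕ.* (suc k ℕ.* f₁))) _)
             (cong (_+_ (+ (a₁ ℕ.* (2 ℕ.* p₁ ℕ.* (suc k ℕ.* f₁))))) (trans (ℤ.pos-* (b₁ ℕ.* (c₁ ℕ.* (p₁ ℕ.* f₁))) _) (cong (_* + (2 ℕ.* suc k)) (ℤ.pos-* b₁ _)))) ⟩
  + (a₁ ℕ.* (2 ℕ.* p₁ ℕ.* (suc k ℕ.* f₁))) + + b₁ * + (c₁ ℕ.* (p₁ ℕ.* f₁)) * + (2 ℕ.* suc k)
    ≡⟨ cong₂ (λ a c → a + + b₁ * c * + (2 ℕ.* suc k)) (matchings-fall n (suc k)) (matchings-fall n k) ⟩
  fall (+ n) (2 ℕ.* suc k) + + b₁ * fall (+ n) (2 ℕ.* k) * + (2 ℕ.* suc k)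
    ≡⟨ cong₃ (λ a b c → fall (+ n) a + b * + c) (2*suc k) (∸-times-fall n k) (2*suc k) ⟩
  fall (+ n) (suc (suc (2 ℕ.* k))) + fall (+ n) (suc (2 ℕ.* k)) * + suc (suc (2 ℕ.* k))
    ≡⟨ cong (_+_ (fall (+ n) (suc (suc (2 ℕ.* k))))) (ℤ.*-comm (fall (+ n) (suc (2 ℕ.* k))) (+ suc (suc (2 ℕ.* k)))) ⟩
  fall (+ n) (suc (suc (2 ℕ.* k))) + + suc (suc (2 ℕ.* k)) * fall (+ n) (suc (2 ℕ.* k))
    ≡⟨ fall-pascal (+ n) (suc (2 ℕ.* k)) ⟨
  fall (+ (n ℕ.+ 1)) (suc (suc (2 ℕ.* k)))
    ≡⟨ cong₂ (λ v j → fall (+ v) j) (ℕ.+-comm n 1) (sym (2*suc k)) ⟩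
  fall (+ suc n) (2 ℕ.* suc k) ∎
  where
  open ≡-Reasoning
  a₁ = matchings n (suc k)
  b₁ = n ∸ 2 ℕ.* k
  c₁ = matchings n k
  p₁ = 2 ℕ.^ k
  f₁ = k !
  split : ∀ a₁ b₁ c₁ p₁ f₁ k → (a₁ ℕ.+ b₁ ℕ.* c₁) ℕ.* (2 ℕ.* p₁ ℕ.* (suc k ℕ.* f₁))
                          ≡ a₁ ℕ.* (2 ℕ.* p₁ ℕ.* (suc k ℕ.* f₁)) ℕ.+ b₁ ℕ.* (c₁ ℕ.* (p₁ ℕ.* f₁)) ℕ.* (2 ℕ.* suc k)
  split = solve-∀ℕ

T≡matchings : ∀ n k → T n k ≡ matchings n k
T≡matchings n k = trans (ℕ./-congˡ {o = d} {{d≢0}} (ℤ.+-injective (trans (fallℕ≡fall n (2 ℕ.* k)) (sym (matchings-fall n k)))))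
                        (ℕ.m*n/n≡m (matchings n k) d {{d≢0}})
  where
  d = 2 ℕ.^ k ℕ.* k !
  d≢0 : ℕ.NonZero d
  d≢0 = ℕ.m*n≢0 (2 ℕ.^ k) (k !) {{ℕ.m^n≢0 2 k}} {{k ℕ.!≢0}}

matchings-suc : ∀ n k → + matchings (suc n) (suc k) ≡ + matchings n (suc k) + (+ n - + (2 ℕ.* k)) * + matchings n k
matchings-suc n k = trans (ℤ.pos-+ (matchings n (suc k)) _) (cong (_+_ (+ matchings n (suc k))) (trans (ℤ.pos-* (n ∸ 2 ℕ.* k) (matchings n k)) lower))
  where
  lower : + (n ∸ 2 ℕ.* k) * + matchings n k ≡ (+ n - + (2 ℕ.* k)) * + matchings n k
  lower with ℕ.≤-<-connex (2 ℕ.* k) n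
  ... | inj₁ 2k≤n = cong (_* + matchings n k) (+-∸ 2k≤n)
  ... | inj₂ n<2k = begin
    + (n ∸ 2 ℕ.* k) * + matchings n k       ≡⟨ cong (λ c → + (n ∸ 2 ℕ.* k) * + c) (matchings-zero {n} {k} n<2k) ⟩
    + (n ∸ 2 ℕ.* k) * 0ℤ                   ≡⟨ ℤ.*-zeroʳ (+ (n ∸ 2 ℕ.* k)) ⟩
    0ℤ                                     ≡⟨ ℤ.*-zeroʳ (+ n - + (2 ℕ.* k)) ⟨
    (+ n - + (2 ℕ.* k)) * 0ℤ               ≡⟨ cong (λ c → (+ n - + (2 ℕ.* k)) * + c) (matchings-zero {n} {k} n<2k) ⟨
    (+ n - + (2 ℕ.* k)) * + matchings n k  ∎
    where open ≡-Reasoning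

-- The odd case

+1-1 : ∀ u → u + 1ℤ - 1ℤ ≡ u
+1-1 = solve-∀

-1+1 : ∀ u → u - 1ℤ + 1ℤ ≡ u
-1+1 = solve-∀

colouringsMN-odd : ∀ n m s r u →
  colouringsMN n m s (r + 1ℤ) (u + 1ℤ)
    ≡ colouringsMN n m s r u + + m * colouringsMN n (m ∸ 1) s r u + + n * colouringsMN (n ∸ 1) m s r u
colouringsMN-odd zero    zero    s r u = refl
colouringsMN-odd (suc n) zero    s r u = trans (fall-pascal u n) (insert-zero (fall u (suc n)) (+ suc n * fall u n))
  where
  insert-zero : ∀ a b → a + b ≡ a + 0ℤ * a + b
  insert-zero = solve-∀
colouringsMN-odd n (suc m) s r u = begin
  s * colouringsMN n m (s - 1ℤ) (r + 1ℤ) (u + 1ℤ) + (r + 1ℤ) * colouringsMN n m s (r + 1ℤ - 1ℤ) (u + 1ℤ - 1ℤ)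
    ≡⟨ cong₂ (λ x y → s * x + (r + 1ℤ) * y) (colouringsMN-odd n m (s - 1ℤ) r u) (cong₂ (colouringsMN n m s) (+1-1 r) (+1-1 u)) ⟩
  s * (a + μ * b + ν * c) + (r + 1ℤ) * P
    ≡⟨ expand s r μ ν a b c P ⟩
  s * a + μ * (s * b) + ν * (s * c) + r * P + P
    ≡⟨ cong (λ x → s * a + μ * (s * b) + ν * (s * c) + r * x + P) P≡ ⟩
  s * a + μ * (s * b) + ν * (s * c) + r * (d + μ * e + ν * g) + P
    ≡⟨ collect s r μ ν a b c d e g P ⟩
  (s * a + r * d) + μ * (s * b + r * e) + ν * (s * c + r * g) + P
    ≡⟨ cong (λ x → (s * a + r * d) + x + ν * (s * c + r * g) + P) (peel m) ⟩
  (s * a + r * d) + μ * P + ν * (s * c + r * g) + P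
    ≡⟨ finish (s * a + r * d) μ P (ν * (s * c + r * g)) ⟩
  (s * a + r * d) + (1ℤ + μ) * P + ν * (s * c + r * g) ∎
  where
  open ≡-Reasoning
  μ = + m
  ν = + n
  a = colouringsMN n m (s - 1ℤ) r u
  b = colouringsMN n (m ∸ 1) (s - 1ℤ) r u
  c = colouringsMN (n ∸ 1) m (s - 1ℤ) r u
  P = colouringsMN n m s r u
  d = colouringsMN n m s (r - 1ℤ) (u - 1ℤ)
  e = colouringsMN n (m ∸ 1) s (r - 1ℤ) (u - 1ℤ)
  g = colouringsMN (n ∸ 1) m s (r - 1ℤ) (u - 1ℤ)
  P≡ : P ≡ d + μ * e + ν * g
  P≡ = trans (cong₂ (colouringsMN n m s) (sym (-1+1 r)) (sym (-1+1 u))) (colouringsMN-odd n m s (r - 1ℤ) (u - 1ℤ))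
  peel : ∀ m → + m * (s * colouringsMN n (m ∸ 1) (s - 1ℤ) r u + r * colouringsMN n (m ∸ 1) s (r - 1ℤ) (u - 1ℤ))
               ≡ + m * colouringsMN n m s r u
  peel zero    = trans (ℤ.*-zeroˡ (s * colouringsMN n 0 (s - 1ℤ) r u + r * colouringsMN n 0 s (r - 1ℤ) (u - 1ℤ)))
                       (sym (ℤ.*-zeroˡ (colouringsMN n 0 s r u)))
  peel (suc m) = refl
  expand : ∀ s r μ ν a b c P → s * (a + μ * b + ν * c) + (r + 1ℤ) * P ≡ s * a + μ * (s * b) + ν * (s * c) + r * P + P
  expand = solve-∀
  collect : ∀ s r μ ν a b c d e g P → s * a + μ * (s * b) + ν * (s * c) + r * (d + μ * e + ν * g) + P
                                      ≡ (s * a + r * d) + μ * (s * b + r * e) + ν * (s * c + r * g) + P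
  collect = solve-∀
  finish : ∀ x μ P y → x + μ * P + y + P ≡ x + (1ℤ + μ) * P + y
  finish = solve-∀

-- One extra unused colour that is usable only once (z = 1) splits off the vertex that takes it.
colouringsLMN-odd : ∀ n m l u s r →
  colouringsLMN n m l (u + 1ℤ) s r 1ℤ
    ≡ colouringsLMN n m l u s r 0ℤ + + l * colouringsLMN n m (l ∸ 1) u s r 0ℤ
      + + m * colouringsLMN n (m ∸ 1) l u s r 0ℤ + + n * colouringsLMN (n ∸ 1) m l u s r 0ℤ
colouringsLMN-odd n m zero u s r = trans (colouringsMN-odd n m s r u) (sym (trans (cong expansion (ℤ.+-identityʳ r))
  (drop-zero (colouringsMN n m s r u) (+ m * colouringsMN n (m ∸ 1) s r u) (+ n * colouringsMN (n ∸ 1) m s r u))))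
  where
  expansion : ℤ → ℤ
  expansion x = colouringsMN n m s x u + 0ℤ * colouringsMN n m s x u
                + + m * colouringsMN n (m ∸ 1) s x u + + n * colouringsMN (n ∸ 1) m s x u
  drop-zero : ∀ a b c → a + 0ℤ * a + b + c ≡ a + b + c
  drop-zero = solve-∀
colouringsLMN-odd n m (suc l) u s r = begin
  s * Λ l (u + 1ℤ - 1ℤ) (s - 1ℤ) r 1ℤ + r * Λ l (u + 1ℤ - 1ℤ) (s + 1ℤ) (r - + 2) 1ℤ + 1ℤ * Λ l (u + 1ℤ - 1ℤ) s r 0ℤ
    ≡⟨ cong₃ (λ x y z → s * x + r * y + 1ℤ * z)
             (trans (cong (λ v → Λ l v (s - 1ℤ) r 1ℤ) u-shift) (colouringsLMN-odd n m l u′ (s - 1ℤ) r))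
             (trans (cong (λ v → Λ l v (s + 1ℤ) (r - + 2) 1ℤ) u-shift) (colouringsLMN-odd n m l u′ (s + 1ℤ) (r - + 2)))
             (cong (λ v → Λ l v s r 0ℤ) (+1-1 u)) ⟩
  s * (A₁ + ℓ * B₁ + μ * C₁ + ν * D₁) + r * (A₂ + ℓ * B₂ + μ * C₂ + ν * D₂) + 1ℤ * P
    ≡⟨ expand s r ℓ μ ν A₁ B₁ C₁ D₁ A₂ B₂ C₂ D₂ P X Y Z ⟩
  (s * A₁ + r * A₂ + 0ℤ * X) + ℓ * (s * B₁ + r * B₂) + P + μ * (s * C₁ + r * C₂ + 0ℤ * Y) + ν * (s * D₁ + r * D₂ + 0ℤ * Z)
    ≡⟨ cong (λ x → (s * A₁ + r * A₂ + 0ℤ * X) + x + P + μ * (s * C₁ + r * C₂ + 0ℤ * Y) + ν * (s * D₁ + r * D₂ + 0ℤ * Z)) (peel l) ⟩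
  (s * A₁ + r * A₂ + 0ℤ * X) + ℓ * P + P + μ * (s * C₁ + r * C₂ + 0ℤ * Y) + ν * (s * D₁ + r * D₂ + 0ℤ * Z)
    ≡⟨ finish (s * A₁ + r * A₂ + 0ℤ * X) ℓ P (μ * (s * C₁ + r * C₂ + 0ℤ * Y)) (ν * (s * D₁ + r * D₂ + 0ℤ * Z)) ⟩
  (s * A₁ + r * A₂ + 0ℤ * X) + (1ℤ + ℓ) * P + μ * (s * C₁ + r * C₂ + 0ℤ * Y) + ν * (s * D₁ + r * D₂ + 0ℤ * Z) ∎
  where
  open ≡-Reasoning
  Λ : ℕ → ℤ → ℤ → ℤ → ℤ → ℤ
  Λ = colouringsLMN n m
  u′ = u - 1ℤ
  u-shift : u + 1ℤ - 1ℤ ≡ u′ + 1ℤ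
  u-shift = trans (+1-1 u) (sym (-1+1 u))
  ℓ = + l
  μ = + m
  ν = + n
  A₁ = colouringsLMN n m l u′ (s - 1ℤ) r 0ℤ
  B₁ = colouringsLMN n m (l ∸ 1) u′ (s - 1ℤ) r 0ℤ
  C₁ = colouringsLMN n (m ∸ 1) l u′ (s - 1ℤ) r 0ℤ
  D₁ = colouringsLMN (n ∸ 1) m l u′ (s - 1ℤ) r 0ℤ
  A₂ = colouringsLMN n m l u′ (s + 1ℤ) (r - + 2) 0ℤ
  B₂ = colouringsLMN n m (l ∸ 1) u′ (s + 1ℤ) (r - + 2) 0ℤ
  C₂ = colouringsLMN n (m ∸ 1) l u′ (s + 1ℤ) (r - + 2) 0ℤ
  D₂ = colouringsLMN (n ∸ 1) m l u′ (s + 1ℤ) (r - + 2) 0ℤ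
  P = colouringsLMN n m l u s r 0ℤ
  X = colouringsLMN n m l u′ s r (0ℤ - 1ℤ)
  Y = colouringsLMN n (m ∸ 1) l u′ s r (0ℤ - 1ℤ)
  Z = colouringsLMN (n ∸ 1) m l u′ s r (0ℤ - 1ℤ)
  peel : ∀ l → + l * (s * colouringsLMN n m (l ∸ 1) u′ (s - 1ℤ) r 0ℤ + r * colouringsLMN n m (l ∸ 1) u′ (s + 1ℤ) (r - + 2) 0ℤ)
               ≡ + l * colouringsLMN n m l u s r 0ℤ
  peel zero    = trans (ℤ.*-zeroˡ (s * colouringsLMN n m 0 u′ (s - 1ℤ) r 0ℤ + r * colouringsLMN n m 0 u′ (s + 1ℤ) (r - + 2) 0ℤ))
                       (sym (ℤ.*-zeroˡ (colouringsLMN n m 0 u s r 0ℤ)))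
  peel (suc l) = cong (+ suc l *_) (add-zero (s * colouringsLMN n m l u′ (s - 1ℤ) r 0ℤ + r * colouringsLMN n m l u′ (s + 1ℤ) (r - + 2) 0ℤ) (colouringsLMN n m l u′ s r (0ℤ - 1ℤ)))
    where
    add-zero : ∀ a w → a ≡ a + 0ℤ * w
    add-zero = solve-∀
  expand : ∀ s r ℓ μ ν A₁ B₁ C₁ D₁ A₂ B₂ C₂ D₂ P X Y Z →
    s * (A₁ + ℓ * B₁ + μ * C₁ + ν * D₁) + r * (A₂ + ℓ * B₂ + μ * C₂ + ν * D₂) + 1ℤ * P
      ≡ (s * A₁ + r * A₂ + 0ℤ * X) + ℓ * (s * B₁ + r * B₂) + P + μ * (s * C₁ + r * C₂ + 0ℤ * Y) + ν * (s * D₁ + r * D₂ + 0ℤ * Z)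
  expand = solve-∀
  finish : ∀ a ℓ P b c → a + ℓ * P + P + b + c ≡ a + (1ℤ + ℓ) * P + b + c
  finish = solve-∀

-- The closed form for even λ

Terminal : Set
Terminal = ℤ → ℤ → ℤ → ℤ

-- colouringsLMN with no zero colour, ending in an arbitrary function of (u, s, r) instead of colouringsMN.
pairing : ℕ → Terminal → Terminal
pairing zero    Φ u s r = Φ u s r
pairing (suc l) Φ u s r = s * pairing l Φ (u - 1ℤ) (s - 1ℤ) r + r * pairing l Φ (u - 1ℤ) (s + 1ℤ) (r - + 2)

pairing-step : Terminal → Terminal
pairing-step Φ u s r = s * Φ (u - 1ℤ) (s - 1ℤ) r + r * Φ (u - 1ℤ) (s + 1ℤ) (r - + 2)

pairing-suc : ∀ l Φ u s r → pairing (suc l) Φ u s r ≡ pairing l (pairing-step Φ) u s r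
pairing-suc zero    Φ u s r = refl
pairing-suc (suc l) Φ u s r = cong₂ (λ a b → s * a + r * b) (pairing-suc l Φ _ _ _) (pairing-suc l Φ _ _ _)

colouringsLMN≡pairing : ∀ n m l u s r → colouringsLMN n m l u s r 0ℤ ≡ pairing l (λ u s r → colouringsMN n m s r u) u s r
colouringsLMN≡pairing n m zero    u s r = cong (λ x → colouringsMN n m s x u) (ℤ.+-identityʳ r)
colouringsLMN≡pairing n m (suc l) u s r =
  trans (drop-zero (s * colouringsLMN n m l (u - 1ℤ) (s - 1ℤ) r 0ℤ + r * colouringsLMN n m l (u - 1ℤ) (s + 1ℤ) (r - + 2) 0ℤ)
                   (colouringsLMN n m l (u - 1ℤ) s r (0ℤ - 1ℤ)))
        (cong₂ (λ a b → s * a + r * b) (colouringsLMN≡pairing n m l _ _ _) (colouringsLMN≡pairing n m l _ _ _))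
  where
  drop-zero : ∀ a w → a + 0ℤ * w ≡ a
  drop-zero = solve-∀

-- Starting from s = 0, after l steps exactly j pairs have been completed with weight matchings l j.
pairing-closed : ∀ l Φ u r → pairing l Φ u 0ℤ r
  ≡ ∑[ j < suc l ] (+ matchings l j * fall₂ r (l ∸ j) * Φ (u - + l) (+ l - + (2 ℕ.* j)) (r - + (2 ℕ.* (l ∸ j))))
pairing-closed zero Φ u r = sym (trans (lonely (Φ (u - 0ℤ) 0ℤ (r - 0ℤ))) (cong₂ (λ a b → Φ a 0ℤ b) (ℤ.+-identityʳ u) (ℤ.+-identityʳ r)))
  where
  lonely : ∀ x → 0ℤ + 1ℤ * 1ℤ * x ≡ x
  lonely = solve-∀
pairing-closed (suc l) Φ u r = begin
  pairing (suc l) Φ u 0ℤ r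
    ≡⟨ trans (pairing-suc l Φ u 0ℤ r) (pairing-closed l (pairing-step Φ) u r) ⟩
  ∑[ j < suc l ] (+ matchings l j * fall₂ r (l ∸ j) * pairing-step Φ (u - + l) (+ l - + (2 ℕ.* j)) (r - + (2 ℕ.* (l ∸ j))))
    ≡⟨ trans (∑<-cong (suc l) split) (∑<-+ (suc l) closes opens) ⟩
  ∑< (suc l) closes + ∑< (suc l) opens
    ≡⟨ cong (_+_ (∑< (suc l) closes)) (trans (∑<-suc l opens) (cong (_+_ (opens 0)) (sym extend))) ⟩
  ∑< (suc l) closes + (opens 0 + ∑< (suc l) opens′)
    ≡⟨ rotate (∑< (suc l) closes) (opens 0) (∑< (suc l) opens′) ⟩
  opens 0 + (∑< (suc l) opens′ + ∑< (suc l) closes)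
    ≡⟨ cong (_+_ (opens 0)) (trans (sym (∑<-+ (suc l) opens′ closes)) (∑<-cong (suc l) λ j _ → sym (term-suc j))) ⟩
  opens 0 + ∑[ j < suc l ] term (suc j)
    ≡⟨ ∑<-suc (suc l) term ⟨
  ∑< (suc (suc l)) term ∎
  where
  open ≡-Reasoning
  G : ℕ → ℤ
  G j = Φ (u - + suc l) (+ suc l - + (2 ℕ.* j)) (r - + (2 ℕ.* (suc l ∸ j)))
  term closes opens opens′ : ℕ → ℤ
  term    j = + matchings (suc l) j * fall₂ r (suc l ∸ j) * G j
  closes  j = (+ l - + (2 ℕ.* j)) * + matchings l j * fall₂ r (l ∸ j) * G (suc j)
  opens   j = + matchings l j * fall₂ r (suc l ∸ j) * G j
  opens′  j = + matchings l (suc j) * fall₂ r (l ∸ j) * G (suc j)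
  rotate : ∀ a b c → a + (b + c) ≡ b + (c + a)
  rotate = solve-∀
  extend : ∑< (suc l) opens′ ≡ ∑< l opens′
  extend = trans (cong (_+_ (∑< l opens′)) (trans (cong (λ t → + t * fall₂ r (l ∸ l) * G (suc l)) no-matching)
                                                  (trans (cong (_* G (suc l)) (ℤ.*-zeroˡ (fall₂ r (l ∸ l)))) (ℤ.*-zeroˡ (G (suc l))))))
                 (ℤ.+-identityʳ _)
    where
    no-matching : matchings l (suc l) ≡ 0
    no-matching = matchings-zero {l} {suc l} (ℕ.<-≤-trans (ℕ.n<1+n l) (ℕ.m≤n*m (suc l) 2))
  term-suc : ∀ j → term (suc j) ≡ opens′ j + closes j
  term-suc j = trans (cong (λ t → t * fall₂ r (l ∸ j) * G (suc j)) (matchings-suc l j))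
                     (distrib (+ matchings l (suc j)) (+ l - + (2 ℕ.* j)) (+ matchings l j) (fall₂ r (l ∸ j)) (G (suc j)))
    where
    distrib : ∀ a b c f g → (a + b * c) * f * g ≡ a * f * g + b * c * f * g
    distrib = solve-∀
  split : ∀ j → j < suc l →
    + matchings l j * fall₂ r (l ∸ j) * pairing-step Φ (u - + l) (+ l - + (2 ℕ.* j)) (r - + (2 ℕ.* (l ∸ j))) ≡ closes j + opens j
  split j j≤l = begin
    + matchings l j * fall₂ r (l ∸ j) * pairing-step Φ (u - + l) (+ l - + (2 ℕ.* j)) R
      ≡⟨ distrib (+ matchings l j) (fall₂ r (l ∸ j)) (+ l - + (2 ℕ.* j)) R _ _ ⟩
    (+ l - + (2 ℕ.* j)) * + matchings l j * fall₂ r (l ∸ j) * Φ (u - + l - 1ℤ) (+ l - + (2 ℕ.* j) - 1ℤ) R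
      + + matchings l j * (fall₂ r (l ∸ j) * R) * Φ (u - + l - 1ℤ) (+ l - + (2 ℕ.* j) + 1ℤ) (R - + 2)
      ≡⟨ cong₃ (λ a b c → (+ l - + (2 ℕ.* j)) * + matchings l j * fall₂ r (l ∸ j) * a + + matchings l j * b * c)
               closing (cong (fall₂ r) (sym suc-l∸j)) opening ⟩
    closes j + opens j ∎
    where
    R = r - + (2 ℕ.* (l ∸ j))
    suc-l∸j : suc l ∸ j ≡ suc (l ∸ j)
    suc-l∸j = ℕ.+-∸-assoc 1 (ℕ.≤-pred j≤l)
    distrib : ∀ T f s R a b → T * f * (s * a + R * b) ≡ s * T * f * a + T * (f * R) * b
    distrib = solve-∀
    shift-u : u - + l - 1ℤ ≡ u - + suc l
    shift-u = shift u (+ l)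
      where
      shift : ∀ u L → u - L - 1ℤ ≡ u - (1ℤ + L)
      shift = solve-∀
    closing : Φ (u - + l - 1ℤ) (+ l - + (2 ℕ.* j) - 1ℤ) R ≡ G (suc j)
    closing = cong₂ (λ a b → Φ a b R) shift-u (trans (shift (+ l) (+ (2 ℕ.* j))) (cong (λ z → + suc l - + z) (sym (2*suc j))))
      where
      shift : ∀ L J → L - J - 1ℤ ≡ (1ℤ + L) - ((1ℤ + 1ℤ) + J)
      shift = solve-∀
    opening : Φ (u - + l - 1ℤ) (+ l - + (2 ℕ.* j) + 1ℤ) (R - + 2) ≡ G j
    opening = cong₃ Φ shift-u (shift (+ l) (+ (2 ℕ.* j)))
                (trans (shift₂ r (+ (2 ℕ.* (l ∸ j)))) (cong (λ z → r - + z) (trans (sym (2*suc (l ∸ j))) (cong (2 ℕ.*_) (sym suc-l∸j)))))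
      where
      shift : ∀ L J → L - J + 1ℤ ≡ (1ℤ + L) - J
      shift = solve-∀
      shift₂ : ∀ r A → r - A - (1ℤ + 1ℤ) ≡ r - ((1ℤ + 1ℤ) + A)
      shift₂ = solve-∀

pairing-const : ∀ l u s r → pairing l (λ _ _ _ → 1ℤ) u s r ≡ fall (s + r) l
pairing-const zero    u s r = refl
pairing-const (suc l) u s r =
  trans (cong₂ (λ a b → s * a + r * b) (trans (pairing-const l _ _ _) (cong (λ v → fall v l) (left s r)))
                                        (trans (pairing-const l _ _ _) (cong (λ v → fall v l) (right s r))))
        (sym (trans (fall-suc (s + r) l) (ℤ.*-distribʳ-+ (fall (s + r - 1ℤ) l) s r)))
  where
  left : ∀ s r → s - 1ℤ + r ≡ s + r - 1ℤ
  left = solve-∀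
  right : ∀ s r → s + 1ℤ + (r - + 2) ≡ s + r - 1ℤ
  right = solve-∀

fall-matchings : ∀ a y → fall y a ≡ ∑[ k < suc a ] (+ matchings a k * fall₂ y (a ∸ k))
fall-matchings a y = begin
  fall y a                                       ≡⟨ cong (λ v → fall v a) (ℤ.+-identityˡ y) ⟨
  fall (0ℤ + y) a                                ≡⟨ pairing-const a 0ℤ 0ℤ y ⟨
  pairing a (λ _ _ _ → 1ℤ) 0ℤ 0ℤ y               ≡⟨ pairing-closed a (λ _ _ _ → 1ℤ) 0ℤ y ⟩
  ∑[ k < suc a ] (+ matchings a k * fall₂ y (a ∸ k) * 1ℤ)
                                                 ≡⟨ ∑<-cong (suc a) (λ k _ → ℤ.*-identityʳ _) ⟩
  ∑[ k < suc a ] (+ matchings a k * fall₂ y (a ∸ k)) ∎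
  where open ≡-Reasoning

colouringsMN-term : ℕ → ℕ → ℤ → ℤ → ℤ → ℕ → ℤ
colouringsMN-term n m s r u i = + (m C i) * fall s i * fall r (m ∸ i) * fall (u - + (m ∸ i)) n

colouringsMN-closed : ∀ n m s r u → colouringsMN n m s r u ≡ ∑< (suc m) (colouringsMN-term n m s r u)
colouringsMN-closed n zero s r u = sym (trans (lonely (fall (u - + 0) n)) (cong (λ v → fall v n) (ℤ.+-identityʳ u)))
  where
  lonely : ∀ x → 0ℤ + 1ℤ * 1ℤ * 1ℤ * x ≡ x
  lonely = solve-∀
colouringsMN-closed n (suc m) s r u = begin
  s * colouringsMN n m (s - 1ℤ) r u + r * colouringsMN n m s (r - 1ℤ) (u - 1ℤ)
    ≡⟨ cong₂ (λ a b → s * a + r * b) (colouringsMN-closed n m (s - 1ℤ) r u) (colouringsMN-closed n m s (r - 1ℤ) (u - 1ℤ)) ⟩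
  s * ∑< (suc m) (colouringsMN-term n m (s - 1ℤ) r u) + r * ∑< (suc m) (colouringsMN-term n m s (r - 1ℤ) (u - 1ℤ))
    ≡⟨ cong₂ _+_ (trans (*-∑< (suc m) s _) (∑<-cong (suc m) (λ i _ → reuse≡ i))) (trans (*-∑< (suc m) r _) (∑<-cong (suc m) fresh≡)) ⟩
  ∑< (suc m) a + ∑< (suc m) b
    ≡⟨ cong (λ z → ∑< (suc m) a + z) (∑<-suc m b) ⟩
  ∑< (suc m) a + (b 0 + ∑< m (λ i → b (suc i)))
    ≡⟨ cong (λ z → ∑< (suc m) a + (b 0 + z)) (∑<-cong m fresh-shift) ⟩
  ∑< (suc m) a + (b 0 + ∑< m c)
    ≡⟨ cong (λ z → ∑< (suc m) a + (b 0 + z)) (sym (trans (cong (λ z → ∑< m c + z) fresh-last) (ℤ.+-identityʳ _))) ⟩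
  ∑< (suc m) a + (b 0 + ∑< (suc m) c)
    ≡⟨ rotate (∑< (suc m) a) (b 0) (∑< (suc m) c) ⟩
  b 0 + (∑< (suc m) a + ∑< (suc m) c)
    ≡⟨ cong₂ _+_ fresh-first (sym (trans (∑<-cong (suc m) (λ i _ → term-pascal i)) (∑<-+ (suc m) a c))) ⟩
  colouringsMN-term n (suc m) s r u 0 + ∑< (suc m) (λ i → colouringsMN-term n (suc m) s r u (suc i))
    ≡⟨ sym (∑<-suc (suc m) (colouringsMN-term n (suc m) s r u)) ⟩
  ∑< (suc (suc m)) (colouringsMN-term n (suc m) s r u) ∎
  where
  open ≡-Reasoning
  F : ℤ → ℤ
  F v = fall v n
  a b c : ℕ → ℤ
  a i = + (m C i) * fall s (suc i) * fall r (m ∸ i) * F (u - + (m ∸ i))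
  b i = + (m C i) * fall s i * fall r (suc (m ∸ i)) * F (u - 1ℤ - + (m ∸ i))
  c i = + (m C suc i) * fall s (suc i) * fall r (m ∸ i) * F (u - + (m ∸ i))
  rotate : ∀ x y z → x + (y + z) ≡ y + (x + z)
  rotate = solve-∀
  reuse≡ : ∀ i → s * colouringsMN-term n m (s - 1ℤ) r u i ≡ a i
  reuse≡ i = trans (regroup s (+ (m C i)) (fall (s - 1ℤ) i) (fall r (m ∸ i)) (F (u - + (m ∸ i))))
               (cong (λ z → + (m C i) * z * fall r (m ∸ i) * F (u - + (m ∸ i))) (sym (fall-suc s i)))
    where
    regroup : ∀ s C A B D → s * (C * A * B * D) ≡ C * (s * A) * B * D
    regroup = solve-∀
  fresh≡ : ∀ i → i < suc m → r * colouringsMN-term n m s (r - 1ℤ) (u - 1ℤ) i ≡ b i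
  fresh≡ i _ = trans (regroup r (+ (m C i)) (fall s i) (fall (r - 1ℤ) (m ∸ i)) (F (u - 1ℤ - + (m ∸ i))))
                 (cong (λ z → + (m C i) * fall s i * z * F (u - 1ℤ - + (m ∸ i))) (sym (fall-suc r (m ∸ i))))
    where
    regroup : ∀ r C A B D → r * (C * A * B * D) ≡ C * A * (r * B) * D
    regroup = solve-∀
  fresh-shift : ∀ i → i < m → b (suc i) ≡ c i
  fresh-shift i lt = cong₂ (λ x y → + (m C suc i) * fall s (suc i) * fall r x * F y) suc-m∸suc-i (trans (regroup u (+ (m ∸ suc i))) (cong (λ z → u - + z) suc-m∸suc-i))
    where
    suc-m∸suc-i : suc (m ∸ suc i) ≡ m ∸ i
    suc-m∸suc-i = sym (ℕ.+-∸-assoc 1 lt)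
    regroup : ∀ u K → u - 1ℤ - K ≡ u - (1ℤ + K)
    regroup = solve-∀
  fresh-last : c m ≡ 0ℤ
  fresh-last = trans (cong (λ z → + z * fall s (suc m) * fall r (m ∸ m) * F (u - + (m ∸ m))) (k>n⇒nCk≡0 (ℕ.n<1+n m)))
         (trans (cong (λ z → z * fall r (m ∸ m) * F (u - + (m ∸ m))) (ℤ.*-zeroˡ (fall s (suc m))))
                (trans (cong (_* F (u - + (m ∸ m))) (ℤ.*-zeroˡ (fall r (m ∸ m)))) (ℤ.*-zeroˡ (F (u - + (m ∸ m))))))
  fresh-first : b 0 ≡ colouringsMN-term n (suc m) s r u 0
  fresh-first = cong (λ z → 1ℤ * 1ℤ * fall r (suc m) * F z) (regroup u (+ m))
    where
    regroup : ∀ u K → u - 1ℤ - K ≡ u - (1ℤ + K)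
    regroup = solve-∀
  term-pascal : ∀ i → colouringsMN-term n (suc m) s r u (suc i) ≡ a i + c i
  term-pascal i = trans (cong (λ z → z * fall s (suc i) * fall r (m ∸ i) * F (u - + (m ∸ i)))
                   (trans (cong +_ (sym (nCk+nC[k+1]≡[n+1]C[k+1] m i))) (ℤ.pos-+ (m C i) (m C suc i))))
           (regroup (+ (m C i)) (+ (m C suc i)) (fall s (suc i)) (fall r (m ∸ i)) (F (u - + (m ∸ i))))
    where
    regroup : ∀ x y A B D → (x + y) * A * B * D ≡ x * A * B * D + y * A * B * D
    regroup = solve-∀

doubleFactorial : ℕ → ℕ
doubleFactorial j = 2 ℕ.^ j ℕ.* j !

doubleFactorial≢0 : ∀ j → ℕ.NonZero (doubleFactorial j)
doubleFactorial≢0 j = ℕ.m*n≢0 (2 ℕ.^ j) (j !) {{ℕ.m^n≢0 2 j}} {{j ℕ.!≢0}}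

matchings-fall-choose : ∀ l i j → + matchings l j * fall (+ l - + (2 ℕ.* j)) i ≡ + (i ! ℕ.* (l C i)) * + matchings (l ∸ i) j
matchings-fall-choose l i j = ℤ.*-cancelʳ-≡ (+ matchings l j * fall (+ l - + (2 ℕ.* j)) i) (+ (i ! ℕ.* (l C i)) * + matchings (l ∸ i) j) (+ doubleFactorial j) {{doubleFactorial≢0 j}} (begin
  + matchings l j * fall (+ l - + (2 ℕ.* j)) i * D
    ≡⟨ regroup (+ matchings l j) (fall (+ l - + (2 ℕ.* j)) i) D ⟩
  (+ matchings l j * D) * fall (+ l - + (2 ℕ.* j)) i
    ≡⟨ cong (_* fall (+ l - + (2 ℕ.* j)) i) (trans (sym (ℤ.pos-* (matchings l j) (doubleFactorial j))) (matchings-fall l j)) ⟩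
  fall (+ l) (2 ℕ.* j) * fall (+ l - + (2 ℕ.* j)) i
    ≡⟨ sym (fall-split (+ l) (2 ℕ.* j) i) ⟩
  fall (+ l) (2 ℕ.* j ℕ.+ i)
    ≡⟨ cong (fall (+ l)) (ℕ.+-comm (2 ℕ.* j) i) ⟩
  fall (+ l) (i ℕ.+ 2 ℕ.* j)
    ≡⟨ fall-split (+ l) i (2 ℕ.* j) ⟩
  fall (+ l) i * fall (+ l - + i) (2 ℕ.* j)
    ≡⟨ h ⟩
  fall (+ l) i * fall (+ (l ∸ i)) (2 ℕ.* j)
    ≡⟨ cong₂ _*_ (sym (factorial-choose l i)) (trans (sym (matchings-fall (l ∸ i) j)) (ℤ.pos-* (matchings (l ∸ i) j) (doubleFactorial j))) ⟩
  + (i ! ℕ.* (l C i)) * (+ matchings (l ∸ i) j * D)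
    ≡⟨ sym (ℤ.*-assoc (+ (i ! ℕ.* (l C i))) (+ matchings (l ∸ i) j) D) ⟩
  + (i ! ℕ.* (l C i)) * + matchings (l ∸ i) j * D ∎)
  where
  open ≡-Reasoning
  D = + doubleFactorial j
  regroup : ∀ a b d → a * b * d ≡ (a * d) * b
  regroup = solve-∀
  h : fall (+ l) i * fall (+ l - + i) (2 ℕ.* j) ≡ fall (+ l) i * fall (+ (l ∸ i)) (2 ℕ.* j)
  h with ℕ.≤-<-connex i l
  ... | inj₁ le = cong (λ v → fall (+ l) i * fall v (2 ℕ.* j)) (sym (+-∸ {l} {i} le))
  ... | inj₂ l<i rewrite fall-zero {l} {i} l<i =
    trans (ℤ.*-zeroˡ (fall (+ l - + i) (2 ℕ.* j))) (sym (ℤ.*-zeroˡ (fall (+ (l ∸ i)) (2 ℕ.* j))))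

∸-regroup : ∀ l m i j k → j ≤ l → i ≤ m → k ≤ m ∸ i → (l ∸ j) ℕ.+ ((m ∸ i) ∸ k) ≡ l ℕ.+ m ∸ i ∸ j ∸ k
∸-regroup l m i j k jl im km = sym (trans (cong₂ (λ x y → x ℕ.+ y ∸ i ∸ j ∸ k) (sym (ℕ.m+[n∸m]≡n jl)) (trans (sym (ℕ.m+[n∸m]≡n im)) (cong (i ℕ.+_) (sym (ℕ.m+[n∸m]≡n km)))))
  (gen (l ∸ j) ((m ∸ i) ∸ k) i j k))
  where
  gen : ∀ a c i j k → (j ℕ.+ a) ℕ.+ (i ℕ.+ (k ℕ.+ c)) ∸ i ∸ j ∸ k ≡ a ℕ.+ c
  gen a c i j k = trans (cong (λ z → z ∸ i ∸ j ∸ k) (nl a c i j k))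
    (trans (cong (λ z → z ∸ j ∸ k) (ℕ.m+n∸m≡n i _)) (trans (cong (_∸ k) (ℕ.m+n∸m≡n j _)) (ℕ.m+n∸m≡n k _)))
    where
    nl : ∀ a c i j k → (j ℕ.+ a) ℕ.+ (i ℕ.+ (k ℕ.+ c)) ≡ i ℕ.+ (j ℕ.+ (k ℕ.+ (a ℕ.+ c)))
    nl = solve-∀ℕ

*-∑<-* : ∀ n (f : ℕ → ℤ) p q → p * ∑< n f * q ≡ ∑< n (λ k → p * f k * q)
*-∑<-* n f p q = trans (cong (_* q) (*-∑< n p f)) (trans (ℤ.*-comm _ q) (trans (*-∑< n q _) (∑<-cong n (λ k _ → ℤ.*-comm q _))))

/2<⇒<2* : ∀ a j → a ℕ./ 2 < j → a < 2 ℕ.* j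
/2<⇒<2* a j a/2<j = begin-strict
  a                            ≡⟨ ℕ.m≡m%n+[m/n]*n a 2 ⟩
  a ℕ.% 2 ℕ.+ (a ℕ./ 2) ℕ.* 2  <⟨ ℕ.+-monoˡ-< ((a ℕ./ 2) ℕ.* 2) (ℕ.m%n<n a 2) ⟩
  2 ℕ.+ (a ℕ./ 2) ℕ.* 2        ≡⟨ shape (a ℕ./ 2) ⟩
  2 ℕ.* suc (a ℕ./ 2)          ≤⟨ ℕ.*-monoʳ-≤ 2 a/2<j ⟩
  2 ℕ.* j                      ∎
  where
  open ℕ.≤-Reasoning
  shape : ∀ q → 2 ℕ.+ q ℕ.* 2 ≡ 2 ℕ.* suc q
  shape = solve-∀ℕ

T-zero : ∀ {n k} → n ℕ./ 2 < k → T n k ≡ 0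
T-zero {n} {k} n/2<k = trans (T≡matchings n k) (matchings-zero {n} {k} (/2<⇒<2* n k n/2<k))

module _ (l m n : ℕ) (X : ℤ) where

  H₃-coefficient : ℕ → ℕ → ℕ → ℕ
  H₃-coefficient i j k = i ! ℕ.* (l C i) ℕ.* (m C i) ℕ.* T (l ∸ i) j ℕ.* T (m ∸ i) k

  H₃-term : ℕ → ℕ → ℕ → ℤ
  H₃-term i j k = + H₃-coefficient i j k * fall₂ X (l ℕ.+ m ∸ i ∸ j ∸ k) * fall (X - + l - + m + + i) n

  H₃-term-zero : ∀ i j k → H₃-coefficient i j k ≡ 0 → H₃-term i j k ≡ 0ℤ
  H₃-term-zero i j k c≡0 rewrite c≡0 =
    trans (cong (_* fall (X - + l - + m + + i) n) (ℤ.*-zeroˡ (fall₂ X (l ℕ.+ m ∸ i ∸ j ∸ k)))) (ℤ.*-zeroˡ (fall (X - + l - + m + + i) n))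

  -- The sums of H₃ stop where C(l, i) and T vanish; extending them to fixed ranges lets us reorder.
  H₃-full-range : H₃ l m n X ≡ ∑[ i < suc m ] ∑[ j < suc l ] ∑[ k < suc (m ∸ i) ] H₃-term i j k
  H₃-full-range = begin
    H₃ l m n X
      ≡⟨ Σ[0≤]≡∑< (l ⊓ m) (λ i → Σ[0≤ (l ∸ i) ℕ./ 2 ] λ j → Σ[0≤ (m ∸ i) ℕ./ 2 ] λ k → H₃-term i j k) ⟩
    ∑[ i < suc (l ⊓ m) ] (Σ[0≤ (l ∸ i) ℕ./ 2 ] λ j → Σ[0≤ (m ∸ i) ℕ./ 2 ] λ k → H₃-term i j k)
      ≡⟨ ∑<-cong (suc (l ⊓ m)) (λ i _ → trans (Σ[0≤]≡∑< ((l ∸ i) ℕ./ 2) (λ j → Σ[0≤ (m ∸ i) ℕ./ 2 ] λ k → H₃-term i j k))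
                                            (∑<-cong (suc ((l ∸ i) ℕ./ 2)) λ j _ → Σ[0≤]≡∑< ((m ∸ i) ℕ./ 2) (λ k → H₃-term i j k))) ⟩
    ∑[ i < suc (l ⊓ m) ] ∑[ j < suc ((l ∸ i) ℕ./ 2) ] ∑[ k < suc ((m ∸ i) ℕ./ 2) ] H₃-term i j k
      ≡⟨ ∑<-cong (suc (l ⊓ m)) (λ i _ → trans (∑<-cong (suc ((l ∸ i) ℕ./ 2)) λ j _ → extend-k i j) (extend-j i)) ⟩
    ∑[ i < suc (l ⊓ m) ] ∑[ j < suc l ] ∑[ k < suc (m ∸ i) ] H₃-term i j k
      ≡⟨ extend-i ⟨
    ∑[ i < suc m ] ∑[ j < suc l ] ∑[ k < suc (m ∸ i) ] H₃-term i j k ∎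
    where
    open ≡-Reasoning
    extend-k : ∀ i j → ∑[ k < suc ((m ∸ i) ℕ./ 2) ] H₃-term i j k ≡ ∑[ k < suc (m ∸ i) ] H₃-term i j k
    extend-k i j = sym (∑<-extend {suc ((m ∸ i) ℕ./ 2)} {suc (m ∸ i)} (H₃-term i j) (s≤s (ℕ.m/n≤m (m ∸ i) 2)) λ k k>half _ →
      H₃-term-zero i j k (trans (cong (i ! ℕ.* (l C i) ℕ.* (m C i) ℕ.* T (l ∸ i) j ℕ.*_) (T-zero {m ∸ i} {k} k>half))
                          (ℕ.*-zeroʳ (i ! ℕ.* (l C i) ℕ.* (m C i) ℕ.* T (l ∸ i) j))))
    extend-j : ∀ i → ∑[ j < suc ((l ∸ i) ℕ./ 2) ] ∑[ k < suc (m ∸ i) ] H₃-term i j k ≡ ∑[ j < suc l ] ∑[ k < suc (m ∸ i) ] H₃-term i j k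
    extend-j i = sym (∑<-extend {suc ((l ∸ i) ℕ./ 2)} {suc l} (λ j → ∑[ k < suc (m ∸ i) ] H₃-term i j k) (s≤s (ℕ.≤-trans (ℕ.m/n≤m (l ∸ i) 2) (ℕ.m∸n≤m l i))) λ j j>half _ →
      ∑<-zero (suc (m ∸ i)) _ λ k _ → H₃-term-zero i j k
        (trans (cong (λ t → i ! ℕ.* (l C i) ℕ.* (m C i) ℕ.* t ℕ.* T (m ∸ i) k) (T-zero {l ∸ i} {j} j>half))
               (cong (ℕ._* T (m ∸ i) k) (ℕ.*-zeroʳ (i ! ℕ.* (l C i) ℕ.* (m C i))))))
    extend-i : ∑[ i < suc m ] ∑[ j < suc l ] ∑[ k < suc (m ∸ i) ] H₃-term i j k ≡ ∑[ i < suc (l ⊓ m) ] ∑[ j < suc l ] ∑[ k < suc (m ∸ i) ] H₃-term i j k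
    extend-i = ∑<-extend {suc (l ⊓ m)} {suc m} (λ i → ∑[ j < suc l ] ∑[ k < suc (m ∸ i) ] H₃-term i j k) (s≤s (ℕ.m⊓n≤n l m)) λ i i>l⊓m i≤m →
      ∑<-zero (suc l) _ λ j _ → ∑<-zero (suc (m ∸ i)) _ λ k _ → H₃-term-zero i j k
        (trans (cong (λ t → i ! ℕ.* t ℕ.* (m C i) ℕ.* T (l ∸ i) j ℕ.* T (m ∸ i) k)
                     (k>n⇒nCk≡0 (ℕ.≰⇒> λ i≤l → ℕ.<⇒≱ i>l⊓m (ℕ.⊓-glb i≤l (ℕ.≤-pred i≤m)))))
               (cong (λ t → t ℕ.* (m C i) ℕ.* T (l ∸ i) j ℕ.* T (m ∸ i) k) (ℕ.*-zeroʳ (i !))))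

colouringsLMN≡H₃ : ∀ l m n X → colouringsLMN n m l X 0ℤ X 0ℤ ≡ H₃ l m n X
colouringsLMN≡H₃ l m n X = begin
  colouringsLMN n m l X 0ℤ X 0ℤ
    ≡⟨ colouringsLMN≡pairing n m l X 0ℤ X ⟩
  pairing l (λ u s r → colouringsMN n m s r u) X 0ℤ X
    ≡⟨ pairing-closed l (λ u s r → colouringsMN n m s r u) X X ⟩
  ∑< (suc l) (λ j → weightL j * colouringsMN n m (+ l - + (2 ℕ.* j)) (X - + (2 ℕ.* (l ∸ j))) (X - + l))
    ≡⟨ ∑<-cong (suc l) (λ j _ → expand j) ⟩
  ∑< (suc l) (λ j → ∑< (suc m) (λ i → ∑< (suc (m ∸ i)) (λ k → term j i k)))
    ≡⟨ ∑<-comm (suc l) (suc m) (λ j i → ∑< (suc (m ∸ i)) (λ k → term j i k)) ⟩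
  ∑< (suc m) (λ i → ∑< (suc l) (λ j → ∑< (suc (m ∸ i)) (λ k → term j i k)))
    ≡⟨ ∑<-cong (suc m) (λ i il → ∑<-cong (suc l) (λ j jl → ∑<-cong (suc (m ∸ i)) (λ k kl → term≡H₃-term i j k (ℕ.≤-pred il) (ℕ.≤-pred jl) (ℕ.≤-pred kl)))) ⟩
  ∑< (suc m) (λ i → ∑< (suc l) (λ j → ∑< (suc (m ∸ i)) (λ k → H₃-term l m n X i j k)))
    ≡⟨ sym (H₃-full-range l m n X) ⟩
  H₃ l m n X ∎
  where
  open ≡-Reasoning
  weightL : ℕ → ℤ
  weightL j = + matchings l j * fall₂ X (l ∸ j)
  sharedL : ℕ → ℕ → ℤ
  sharedL j i = fall (+ l - + (2 ℕ.* j)) i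
  pairsM : ℕ → ℕ → ℕ → ℤ
  pairsM j i k = fall₂ (X - + (2 ℕ.* (l ∸ j))) ((m ∸ i) ∸ k)
  apex : ℕ → ℤ
  apex i = fall (X - + l - + (m ∸ i)) n
  term : ℕ → ℕ → ℕ → ℤ
  term j i k = (weightL j * (+ (m C i) * sharedL j i)) * (+ matchings (m ∸ i) k * pairsM j i k) * apex i
  expand : ∀ j → weightL j * colouringsMN n m (+ l - + (2 ℕ.* j)) (X - + (2 ℕ.* (l ∸ j))) (X - + l) ≡ ∑< (suc m) (λ i → ∑< (suc (m ∸ i)) (λ k → term j i k))
  expand j = trans (cong (weightL j *_) (colouringsMN-closed n m _ _ _)) (trans (*-∑< (suc m) (weightL j) _) (∑<-cong (suc m) (λ i _ →
    trans (cong (λ z → weightL j * (+ (m C i) * sharedL j i * z * apex i)) (fall-matchings (m ∸ i) (X - + (2 ℕ.* (l ∸ j)))))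
      (trans (rl (weightL j) (+ (m C i)) (sharedL j i) (∑< (suc (m ∸ i)) (λ k → + matchings (m ∸ i) k * pairsM j i k)) (apex i))
        (*-∑<-* (suc (m ∸ i)) (λ k → + matchings (m ∸ i) k * pairsM j i k) (weightL j * (+ (m C i) * sharedL j i)) (apex i))))))
    where
    rl : ∀ weightL C f s N → weightL * (C * f * s * N) ≡ (weightL * (C * f)) * s * N
    rl = solve-∀
  term≡H₃-term : ∀ i j k → i ≤ m → j ≤ l → k ≤ m ∸ i → term j i k ≡ H₃-term l m n X i j k
  term≡H₃-term i j k im jl km = sym (begin
    H₃-term l m n X i j k
      ≡⟨ cong₃ (λ a b d → a * b * d) coefficient≡ pairs≡ apex≡ ⟩
    (I * Cₘ * Tₗ * Tₘ) * (fall₂ X (l ∸ j) * pairsM j i k) * apex i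
      ≡⟨ regroup₁ I Cₘ Tₗ Tₘ (fall₂ X (l ∸ j)) (pairsM j i k) (apex i) ⟩
    ((I * Tₗ) * Cₘ * Tₘ) * (fall₂ X (l ∸ j) * pairsM j i k) * apex i
      ≡⟨ cong (λ z → (z * Cₘ * Tₘ) * (fall₂ X (l ∸ j) * pairsM j i k) * apex i) (sym (matchings-fall-choose l i j)) ⟩
    ((+ matchings l j * sharedL j i) * Cₘ * Tₘ) * (fall₂ X (l ∸ j) * pairsM j i k) * apex i
      ≡⟨ regroup₂ (+ matchings l j) (sharedL j i) Cₘ Tₘ (fall₂ X (l ∸ j)) (pairsM j i k) (apex i) ⟩
    term j i k ∎)
    where
    I = + (i ! ℕ.* (l C i))
    Cₘ = + (m C i)
    Tₗ = + matchings (l ∸ i) j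
    Tₘ = + matchings (m ∸ i) k
    coefficient≡ : + (i ! ℕ.* (l C i) ℕ.* (m C i) ℕ.* T (l ∸ i) j ℕ.* T (m ∸ i) k) ≡ I * Cₘ * Tₗ * Tₘ
    coefficient≡ = trans (ℤ.pos-* (i ! ℕ.* (l C i) ℕ.* (m C i) ℕ.* T (l ∸ i) j) (T (m ∸ i) k))
      (cong₂ _*_ (trans (ℤ.pos-* (i ! ℕ.* (l C i) ℕ.* (m C i)) (T (l ∸ i) j))
                   (cong₂ _*_ (ℤ.pos-* (i ! ℕ.* (l C i)) (m C i)) (cong +_ (T≡matchings (l ∸ i) j))))
                 (cong +_ (T≡matchings (m ∸ i) k)))
    pairs≡ : fall₂ X (l ℕ.+ m ∸ i ∸ j ∸ k) ≡ fall₂ X (l ∸ j) * pairsM j i k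
    pairs≡ = trans (cong (fall₂ X) (sym (∸-regroup l m i j k jl im km))) (fall₂-split X (l ∸ j) ((m ∸ i) ∸ k))
    apex≡ : fall (X - + l - + m + + i) n ≡ apex i
    apex≡ = (cong (λ v → fall v n) (trans (ar X (+ l) (+ m) (+ i)) (cong (λ z → X - + l - z) (sym (+-∸ {m} {i} im)))))
      where
      ar : ∀ X L M I → X - L - M + I ≡ X - L - (M - I)
      ar = solve-∀
    regroup₁ : ∀ I Cₘ Tₗ Tₘ A B N → (I * Cₘ * Tₗ * Tₘ) * (A * B) * N ≡ ((I * Tₗ) * Cₘ * Tₘ) * (A * B) * N
    regroup₁ = solve-∀
    regroup₂ : ∀ Tl f Cₘ Tₘ A B N → ((Tl * f) * Cₘ * Tₘ) * (A * B) * N ≡ (Tl * A * (Cₘ * f)) * (Tₘ * B) * N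
    regroup₂ = solve-∀

colourings-Σ : ∀ l m n h b →
  count (properᵇ (Σ l m n)) (allVecs (palette h b) ((l ℕ.+ m) ℕ.+ n))
    ≡ colouringsLMN n m l (+ h + 𝟙 b + + h) 0ℤ (+ h + 0ℤ + + h) (0ℤ + 𝟙 b + 0ℤ)
colourings-Σ l m n h b = begin
  count (properᵇ (Σ l m n)) (allVecs Cs _)
    ≡⟨ count-cong (allVecs Cs _) (properᵇ≡greedy l m n) ⟩
  colourings none (parts l m n)
    ≡⟨ colourings-LMN n m l none (λ _ → refl) (λ _ → refl) ⟩
  colouringsLMN n m l (count (λ _ → true) Cs) (count (λ _ → false) Cs)
                      (count (λ y → not (isZero y) ∧ true) Cs) (count (λ y → isZero y ∧ true) Cs)
    ≡⟨ cong₄ (colouringsLMN n m l) all≡ (count-false Cs) nonzero≡ zero≡ ⟩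
  colouringsLMN n m l (+ h + 𝟙 b + + h) 0ℤ (+ h + 0ℤ + + h) (0ℤ + 𝟙 b + 0ℤ) ∎
  where
  open ≡-Reasoning
  Cs = palette h b
  open Colourings Cs (palette-unique h b) (palette-symmetric h b)
  upTo-size : count (λ _ → true) (upTo h) ≡ + h
  upTo-size = trans (count-true (upTo h)) (cong +_ (List.length-upTo h))
  zeroIf-size : ∀ b → count (λ _ → true) (zeroIf b) ≡ 𝟙 b
  zeroIf-size true  = refl
  zeroIf-size false = refl
  zeroIf-zero : ∀ b → count (λ y → isZero y ∧ true) (zeroIf b) ≡ 𝟙 b
  zeroIf-zero true  = refl
  zeroIf-zero false = refl
  zeroIf-nonzero : ∀ b → count (λ y → not (isZero y) ∧ true) (zeroIf b) ≡ 0ℤ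
  zeroIf-nonzero true  = refl
  zeroIf-nonzero false = refl
  all≡ : count (λ _ → true) Cs ≡ + h + 𝟙 b + + h
  all≡ = trans (count-palette _ h b) (cong₃ (λ x y z → x + y + z) upTo-size (zeroIf-size b) upTo-size)
  nonzero≡ : count (λ y → not (isZero y) ∧ true) Cs ≡ + h + 0ℤ + + h
  nonzero≡ = trans (count-palette _ h b) (cong₃ (λ x y z → x + y + z) upTo-size (zeroIf-nonzero b) upTo-size)
  zero≡ : count (λ y → isZero y ∧ true) Cs ≡ 0ℤ + 𝟙 b + 0ℤ
  zero≡ = trans (count-palette _ h b) (cong₃ (λ x y z → x + y + z) (count-false (upTo h)) (zeroIf-zero b) (count-false (upTo h)))

half-even : ∀ k → 2 ℕ.* k ℕ./ 2 ≡ k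
half-even k = trans (ℕ./-congˡ (ℕ.*-comm 2 k)) (ℕ.m*n/n≡m k 2)

half-odd : ∀ k → ℕ.suc (2 ℕ.* k) ℕ./ 2 ≡ k
half-odd k = trans (cong (λ z → ℕ.suc z ℕ./ 2) (ℕ.*-comm 2 k))
                   (trans (ℕ.+-distrib-/ 1 (k ℕ.* 2) (subst (λ r → 1 ℕ.+ r ℕ.< 2) (sym (ℕ.m*n%n≡0 k 2)) ℕ.≤-refl))
                          (ℕ.m*n/n≡m k 2))

parity-even : ∀ k → 2 ℕ.* k ℕ.% 2 ≡ 0
parity-even k = trans (cong (ℕ._% 2) (ℕ.*-comm 2 k)) (ℕ.m*n%n≡0 k 2)

parity-odd : ∀ k → ℕ.suc (2 ℕ.* k) ℕ.% 2 ≡ 1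
parity-odd k = trans (cong (λ z → ℕ.suc z ℕ.% 2) (ℕ.*-comm 2 k)) (ℕ.[m+kn]%n≡m%n 1 k 2)

colours-even : ∀ k → colours (2 ℕ.* k) ≡ palette k false
colours-even k = cong₂ palette (half-even k) (cong (λ r → ⌊ r ℕ.≟ 1 ⌋) (parity-even k))

colours-odd : ∀ k → colours (ℕ.suc (2 ℕ.* k)) ≡ palette k true
colours-odd k = cong₂ palette (half-odd k) (cong (λ r → ⌊ r ℕ.≟ 1 ⌋) (parity-odd k))

f-Σ-even : ∀ l m n k → + f (Σ l m n) (2 ℕ.* k) ≡ colouringsLMN n m l (+ (2 ℕ.* k)) 0ℤ (+ (2 ℕ.* k)) 0ℤ
f-Σ-even l m n k = begin
  + f (Σ l m n) (2 ℕ.* k)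
    ≡⟨ length-filter-T? (properᵇ (Σ l m n)) (allVecs (colours (2 ℕ.* k)) _) ⟩
  count (properᵇ (Σ l m n)) (allVecs (colours (2 ℕ.* k)) _)
    ≡⟨ cong (λ Cs → count (properᵇ (Σ l m n)) (allVecs Cs _)) (colours-even k) ⟩
  count (properᵇ (Σ l m n)) (allVecs (palette k false) _)
    ≡⟨ colourings-Σ l m n k false ⟩
  colouringsLMN n m l (+ k + 0ℤ + + k) 0ℤ (+ k + 0ℤ + + k) 0ℤ
    ≡⟨ cong (λ x → colouringsLMN n m l (+ x) 0ℤ (+ x) 0ℤ) (double k) ⟩
  colouringsLMN n m l (+ (2 ℕ.* k)) 0ℤ (+ (2 ℕ.* k)) 0ℤ ∎
  where
  open ≡-Reasoning
  double : ∀ k → k ℕ.+ 0 ℕ.+ k ≡ 2 ℕ.* k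
  double = solve-∀ℕ

f-Σ-odd : ∀ l m n k → let x = + ℕ.suc (2 ℕ.* k) - 1ℤ in
  + f (Σ l m n) (ℕ.suc (2 ℕ.* k)) ≡ colouringsLMN n m l (x + 1ℤ) 0ℤ x 1ℤ
f-Σ-odd l m n k = begin
  + f (Σ l m n) (ℕ.suc (2 ℕ.* k))
    ≡⟨ length-filter-T? (properᵇ (Σ l m n)) (allVecs (colours (ℕ.suc (2 ℕ.* k))) _) ⟩
  count (properᵇ (Σ l m n)) (allVecs (colours (ℕ.suc (2 ℕ.* k))) _)
    ≡⟨ cong (λ Cs → count (properᵇ (Σ l m n)) (allVecs Cs _)) (colours-odd k) ⟩
  count (properᵇ (Σ l m n)) (allVecs (palette k true) _)
    ≡⟨ colourings-Σ l m n k true ⟩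
  colouringsLMN n m l (+ k + 1ℤ + + k) 0ℤ (+ k + 0ℤ + + k) 1ℤ
    ≡⟨ cong₂ (λ u x → colouringsLMN n m l u 0ℤ x 1ℤ) (odd+1 (+ k)) (odd (+ k)) ⟩
  colouringsLMN n m l (+ ℕ.suc (2 ℕ.* k) - 1ℤ + 1ℤ) 0ℤ (+ ℕ.suc (2 ℕ.* k) - 1ℤ) 1ℤ ∎
  where
  open ≡-Reasoning
  odd+1 : ∀ k → k + 1ℤ + k ≡ 1ℤ + (k + (k + 0ℤ)) - 1ℤ + 1ℤ
  odd+1 = solve-∀
  odd : ∀ k → k + 0ℤ + k ≡ 1ℤ + (k + (k + 0ℤ)) - 1ℤ
  odd = solve-∀

proposition3p5 : (l m n : ℕ) →
    (∀ k → + f (((+K l) ∨₋ (+K m)) ∨₊ (+K n)) (2 Data.Nat.* k)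
             ≡ H₃ l m n (+ (2 Data.Nat.* k)))
    × (∀ k → + f (((+K l) ∨₋ (+K m)) ∨₊ (+K n)) (Data.Nat.suc (2 Data.Nat.* k))
             ≡ H₃ l m n (+ Data.Nat.suc (2 Data.Nat.* k) - 1ℤ)
               + + l * H₃ (l ∸ 1) m n (+ Data.Nat.suc (2 Data.Nat.* k) - 1ℤ)
               + + m * H₃ l (m ∸ 1) n (+ Data.Nat.suc (2 Data.Nat.* k) - 1ℤ)
               + + n * H₃ l m (n ∸ 1) (+ Data.Nat.suc (2 Data.Nat.* k) - 1ℤ))
proposition3p5 l m n =
    (λ k → trans (f-Σ-even l m n k) (colouringsLMN≡H₃ l m n _))
  , (λ k → trans (f-Σ-odd l m n k)
      (trans (colouringsLMN-odd n m l _ 0ℤ _)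
             (cong₄ (λ a b c d → a + + l * b + + m * c + + n * d)
                    (colouringsLMN≡H₃ l m n _) (colouringsLMN≡H₃ (l ∸ 1) m n _)
                    (colouringsLMN≡H₃ l (m ∸ 1) n _) (colouringsLMN≡H₃ l m (n ∸ 1) _))))
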